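{- For every positive integer $n$, $$a_n=\sum_{i=1}^{n}\ \prod_{j=1}^{n-1} 2^{\,d_{i,j}+d_{n+1-i,j}}\cdot\bigl(b_{i,j}+b_{n+1-i,j}\bigr)!,$$ where in this formula the convention $d_{p,1}=0$ for all $p$ is used.
   Context: Places $1,\dots,n$ stand in a row; neighbouring places have distance $1$. At any time at which at least one place is occupied, the distance of an empty place $x$ is $\min|x-y|$ over all occupied places $y$. Persons arrive one after another and each occupies one empty place. Politeness rule: every person except the first (who chooses freely unless stated otherwise) occupies one of the empty places whose distance is maximal among all empty places at that time. $a_n$ is the number of sequences $(x_1,\dots,x_n)$ (permutations of $\{1,\dots,n\}$, $x_t$ being the place taken by the $t$-th person) in which $n$ persons fill all $n$ places obeying the politeness rule. For positive integers $p,k$, consider $p$ places filled by $p$ persons according to the politeness rule with the first person taking the leftmost place. $b_{p,k}$ is the number of persons (the first person is not counted) who, at the moment of choosing, occupy a place of distance exactly $k$. For $k\ge 2$, $d_{p,k}$ is the number of different sets of two neighbouring places for which, at some time during the filling, both places are empty and both have distance exactly $k$; moreover, in this statement $d_{p,1}:=0$ for all $p$. These numbers do not depend on the choices made during the filling. Empty products equal $1$. -}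

module Defs where

open import Data.Nat using (ℕ; zero; suc; _+_; _⊓_; _≤_; _≤?_; _<_; z<s; ∣_-_∣)
import Data.Nat.Properties as ℕ
open import Data.Fin using (Fin; zero; toℕ; _≟_)
open import Data.Fin.Properties using (all?; ¬∀⟶∃¬; pigeonhole; <⇒≢)
open import Data.List using (List; []; _∷_; [_]; length; filter; allFin; applyUpTo; cartesianProduct; cartesianProductWith)
open import Data.List.Extrema ℕ.≤-totalOrder using (argmax; argmax-all; f[xs]≤f[argmax])
open import Data.List.Membership.DecPropositional using () renaming (_∈?_ to memberDec)
open import Data.List.Membership.Propositional using (_∈_; _∉_)
open import Data.List.Membership.Propositional.Properties using (∈-filter⁺; ∈-allFin)
open import Data.List.Membership.Setoid.Properties using (index-injective)
open import Data.List.NonEmpty using (List⁺; _∷_; _∷⁺_; toList; foldr₁) renaming (map to map⁺)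
open import Data.List.Relation.Unary.All using () renaming (lookup to lookupAll)
open import Data.List.Relation.Unary.All.Properties using (all-filter)
open import Data.List.Relation.Unary.Any using (Any; any?; index)
open import Data.Product using (Σ; ∃; _×_; _,_; proj₁)
open import Data.Unit using (⊤; tt)
open import Data.Vec using (Vec; []; _∷_)
open import Relation.Binary.PropositionalEquality using (_≡_; refl; subst; sym; trans; setoid)
open import Relation.Nullary using (¬_; Dec; yes; ¬?; _×-dec_; _→-dec_)

-- The places are the elements of Fin p, leftmost place zero.  A value of
-- Occupied p lists the places taken so far, most recent first; distances are
-- defined only once somebody has arrived, hence List⁺.
Occupied : ℕ → Set
Occupied p = List⁺ (Fin p)

Empty : ∀ {p} → Occupied p → Fin p → Set
Empty occ x = x ∉ toList occ

distance : ∀ {p} → Occupied p → Fin p → ℕ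
distance occ x = foldr₁ _⊓_ (map⁺ (λ y → ∣ toℕ x - toℕ y ∣) occ)

PoliteChoice : ∀ {p} → Occupied p → Fin p → Set
PoliteChoice occ x = Empty occ x × (∀ y → Empty occ y → distance occ y ≤ distance occ x)

PoliteAfter : ∀ {p m} → Occupied p → Vec (Fin p) m → Set
PoliteAfter occ []       = ⊤
PoliteAfter occ (x ∷ xs) = PoliteChoice occ x × PoliteAfter (x ∷⁺ occ) xs

-- Everybody takes an empty place, so a polite sequence of p persons on p places
-- is automatically a permutation.
Polite : ∀ {p m} → Vec (Fin p) m → Set
Polite []       = ⊤
Polite (x ∷ xs) = PoliteAfter (x ∷ []) xs

empty? : ∀ {p} (occ : Occupied p) x → Dec (Empty occ x)
empty? occ x = ¬? (memberDec _≟_ x (toList occ))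

politeChoice? : ∀ {p} (occ : Occupied p) x → Dec (PoliteChoice occ x)
politeChoice? occ x =
  empty? occ x ×-dec all? (λ y → empty? occ y →-dec (distance occ y ≤? distance occ x))

politeAfter? : ∀ {p m} (occ : Occupied p) (xs : Vec (Fin p) m) → Dec (PoliteAfter occ xs)
politeAfter? occ []       = yes tt
politeAfter? occ (x ∷ xs) = politeChoice? occ x ×-dec politeAfter? (x ∷⁺ occ) xs

polite? : ∀ {p m} (xs : Vec (Fin p) m) → Dec (Polite xs)
polite? []       = yes tt
polite? (x ∷ xs) = politeAfter? (x ∷ []) xs

-- All vectors of length m over Fin p, each exactly once.
sequences : ∀ p m → List (Vec (Fin p) m)
sequences p zero    = [ [] ]
sequences p (suc m) = cartesianProductWith _∷_ (allFin p) (sequences p m)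

a : ℕ → ℕ
a n = length (filter polite? (sequences n n))

StartsLeftmost : ∀ {p m} → Vec (Fin p) m → Set
StartsLeftmost []      = ⊤
StartsLeftmost (x ∷ _) = toℕ x ≡ 0

-- For p = 0 this is inhabited by the empty sequence only.
LeftFilling : ℕ → Set
LeftFilling p = Σ (Vec (Fin p) p) (λ xs → Polite xs × StartsLeftmost xs)

-- The distances, at the moment of choosing, of the places chosen by the persons
-- after the first.
distancesAfter : ∀ {p m} → Occupied p → Vec (Fin p) m → List ℕ
distancesAfter occ []       = []
distancesAfter occ (x ∷ xs) = distance occ x ∷ distancesAfter (x ∷⁺ occ) xs

chosenDistances : ∀ {p m} → Vec (Fin p) m → List ℕ
chosenDistances []       = []
chosenDistances (x ∷ xs) = distancesAfter (x ∷ []) xs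

statesAfter : ∀ {p m} → Occupied p → Vec (Fin p) m → List (Occupied p)
statesAfter occ []       = [ occ ]
statesAfter occ (x ∷ xs) = occ ∷ statesAfter (x ∷⁺ occ) xs

states : ∀ {p m} → Vec (Fin p) m → List (Occupied p)
states []       = []
states (x ∷ xs) = statesAfter (x ∷ []) xs

BothEmptyAt : ∀ {p} → ℕ → Fin p → Fin p → Occupied p → Set
BothEmptyAt k x y occ =
  (Empty occ x × distance occ x ≡ k) × (Empty occ y × distance occ y ≡ k)

-- A set of two neighbouring places is represented by the pair (x , y) with y the
-- right neighbour of x.
EmptyPair : ∀ {p m} → Vec (Fin p) m → ℕ → Fin p × Fin p → Set
EmptyPair xs k (x , y) = toℕ y ≡ suc (toℕ x) × Any (BothEmptyAt k x y) (states xs)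

emptyPair? : ∀ {p m} (xs : Vec (Fin p) m) k xy → Dec (EmptyPair xs k xy)
emptyPair? xs k (x , y) =
  (toℕ y ℕ.≟ suc (toℕ x)) ×-dec
  any? (λ occ → (empty? occ x ×-dec (distance occ x ℕ.≟ k))
                  ×-dec (empty? occ y ×-dec (distance occ y ℕ.≟ k)))
       (states xs)

-- The numbers b_{p,k} and d_{p,k}, read off from a given filling for each p.
b : (∀ p → LeftFilling p) → ℕ → ℕ → ℕ
b F p k = length (filter (ℕ._≟ k) (chosenDistances (proj₁ (F p))))

d : (∀ p → LeftFilling p) → ℕ → ℕ → ℕ
d F p 1 = 0
d F p k = length (filter (emptyPair? (proj₁ (F p)) k) (cartesianProduct (allFin p) (allFin p)))

1⋯_ : ℕ → List ℕ
1⋯ n = applyUpTo suc n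

-- Fillings as in LeftFilling exist for every p, so quantifying over a family of
-- them is not vacuous.
someEmpty : ∀ {p} (occ : Occupied p) → length (toList occ) < p → ∃ (Empty occ)
someEmpty {p} occ l<p = ¬∀⟶∃¬ p (_∈ toList occ) (λ x → memberDec _≟_ x (toList occ)) notAll
  where
  notAll : ¬ (∀ x → x ∈ toList occ)
  notAll all∈ with i , j , i<j , eq ← pigeonhole l<p (λ x → index (all∈ x)) =
    <⇒≢ i<j (index-injective (setoid _) (all∈ i) (all∈ j) eq)

somePoliteChoice : ∀ {p} (occ : Occupied p) → length (toList occ) < p → ∃ (PoliteChoice occ)
somePoliteChoice {p} occ l<p with x , x-empty ← someEmpty occ l<p =
    argmax (distance occ) x empties
  , argmax-all (distance occ) x-empty (all-filter (empty? occ) (allFin p))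
  , λ y y-empty → lookupAll (f[xs]≤f[argmax] {f = distance occ} x empties)
                            (∈-filter⁺ (empty? occ) (∈-allFin y) y-empty)
  where
  empties = filter (empty? occ) (allFin p)

someFillingAfter : ∀ {p} m (occ : Occupied p) → length (toList occ) + m ≡ p →
                   Σ (Vec (Fin p) m) (PoliteAfter occ)
someFillingAfter zero    occ eq = [] , tt
someFillingAfter (suc m) occ eq
  with x  , px  ← somePoliteChoice occ (subst (length (toList occ) <_) eq (ℕ.m<m+n _ (z<s)))
  with xs , pxs ← someFillingAfter m (x ∷⁺ occ) (trans (sym (ℕ.+-suc _ m)) eq) =
  x ∷ xs , px , pxs

someLeftFilling : ∀ p → LeftFilling p
someLeftFilling zero    = [] , tt , tt
someLeftFilling (suc m) with xs , pxs ← someFillingAfter m (zero ∷ []) refl =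
  zero ∷ xs , pxs , refl

{-# OPTIONS --safe #-}
-- Occupied places cut the row into gaps, and a person who sits down politely sits in
-- the middle of a gap (at the far end, if the gap lies at the edge of the row).  The
-- lengths of the two new gaps do not depend on which of two middle places is taken, so
-- for every statistic of the chosen distances the sum over the remaining persons is a
-- sum over gaps; this gives B and D, the values of b and d for a partly filled row.
-- Let k be the maximal distance.  If x is a polite choice, then passing from occ to
-- x ∷⁺ occ divides the product of the 2 ^ D * B ! by B_k, and also by 2 if x has an
-- empty neighbour at distance k ≥ 2.  For k ≥ 2, each of the B_k gaps where somebody
-- will sit at distance k offers either one x or two with the additional factor 2; for
-- k = 1, all B_1 empty places can be chosen.  So the products after all possible
-- choices add up to the product before, which counts the polite completions of occ.  A first person at place i leaves two edge
-- gaps, those of left fillings of i and of n + 1 - i places.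
module Submission where

open import Defs
open import Algebra.Structures using (IsCommutativeMonoid)
open import Data.Bool using (Bool; true; false; if_then_else_; _∧_; not)
open import Data.Bool.Properties using (∧-zeroʳ; ∧-identityʳ)
open import Data.Empty using (⊥; ⊥-elim)
open import Data.Fin using (Fin; toℕ; fromℕ<) renaming (zero to 0F; suc to sucF; _≟_ to _≟F_)
open import Data.Fin.Properties using (toℕ-injective; toℕ<n; toℕ-fromℕ<)
import Data.Fin.Properties as Fin
open import Data.List using (List; []; _∷_; map; foldr; filter; length; _++_; allFin; tabulate; applyUpTo; cartesianProduct; cartesianProductWith)
open import Data.List.Membership.DecPropositional using () renaming (_∈?_ to memberDec)
open import Data.List.Membership.Propositional using (_∈_)
open import Data.List.Membership.Propositional.Properties using (∈-allFin; ∈-applyUpTo⁺; ∈-applyUpTo⁻; ∈-cartesianProduct⁺)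
open import Data.List.NonEmpty using (_∷_; _∷⁺_; toList)
open import Data.List.Properties using (map-cong; map-++; map-∘; length-tabulate; map-applyUpTo; map-tabulate)
open import Data.List.Relation.Unary.All as All using ([]; _∷_)
open import Data.List.Relation.Unary.AllPairs using ([]; _∷_)
open import Data.List.Relation.Unary.Any using (Any; any?; here; there)
open import Data.List.Relation.Unary.Unique.Propositional using (Unique)
open import Data.List.Relation.Unary.Unique.Propositional.Properties using (allFin⁺; cartesianProduct⁺; applyUpTo⁺₁)
open import Data.Nat
open import Data.Nat.ListAction using (sum; product)
open import Data.Nat.ListAction.Properties using (sum-++)
open import Data.Nat.Properties
open import Data.Product using (∃; _×_; _,_; proj₁; proj₂)
open import Data.Sum using (_⊎_; inj₁; inj₂; [_,_]′; swap)
open import Data.Vec using (Vec; []; _∷_)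
open import Function using (_∘_; mk⇔)
open import Relation.Binary using (tri<; tri≈; tri>)
open import Relation.Binary.PropositionalEquality
open import Relation.Nullary using (¬_; Dec; yes; no; does; contradiction; _×-dec_)
open import Relation.Nullary.Decidable using (dec-true; dec-false; does-⇔)
open import Relation.Unary using (Decidable)

-- Sums and counts

ind : Bool → ℕ
ind true  = 1
ind false = 0

module _ {_∙_ : ℕ → ℕ → ℕ} {ε : ℕ} (isCM : IsCommutativeMonoid _≡_ _∙_ ε) where
  open IsCommutativeMonoid isCM using (assoc; comm)

  fold-cong : ∀ {A : Set} {f g : A → ℕ} xs → (∀ x → x ∈ xs → f x ≡ g x) →
              foldr _∙_ ε (map f xs) ≡ foldr _∙_ ε (map g xs)
  fold-cong []       eq = refl
  fold-cong (x ∷ xs) eq = cong₂ _∙_ (eq x (here refl)) (fold-cong xs (λ y → eq y ∘ there))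

  -- Stated for any commutative monoid on the naturals because it serves both for sums (weights,
  -- empty places, pairs) and for the product `orders`. Uniqueness guarantees that the exceptional
  -- index is met exactly once.
  fold-change-at : ∀ {A : Set} {f g : A → ℕ} {xs k} c → Unique xs → k ∈ xs →
                   f k ≡ c ∙ g k → (∀ x → x ≢ k → f x ≡ g x) →
                   foldr _∙_ ε (map f xs) ≡ c ∙ foldr _∙_ ε (map g xs)
  fold-change-at {f = f} {g} {x ∷ xs} c (x∉ ∷ _) (here refl) eq off =
    trans (cong₂ _∙_ eq (fold-cong xs (λ y y∈ → off y (≢-sym (All.lookup x∉ y∈)))))
          (assoc c _ _)
  fold-change-at {f = f} {g} {x ∷ xs} c (x∉ ∷ u) (there k∈) eq off =
    trans (cong₂ _∙_ (off x (All.lookup x∉ k∈)) (fold-change-at c u k∈ eq off))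
    (trans (sym (assoc (g x) c _))
    (trans (cong (_∙ foldr _∙_ ε (map g xs)) (comm (g x) c)) (assoc c _ _)))

module _ {A : Set} where

  sum-cong : {f g : A → ℕ} (xs : List A) → (∀ x → f x ≡ g x) → sum (map f xs) ≡ sum (map g xs)
  sum-cong xs eq = cong sum (map-cong eq xs)

  sum-zero : {f : A → ℕ} (xs : List A) → (∀ x → f x ≡ 0) → sum (map f xs) ≡ 0
  sum-zero []       eq = refl
  sum-zero (x ∷ xs) eq = cong₂ _+_ (eq x) (sum-zero xs eq)

  sum-*ˡ : (c : ℕ) (f : A → ℕ) (xs : List A) → sum (map (λ x → c * f x) xs) ≡ c * sum (map f xs)
  sum-*ˡ c f []       = sym (*-zeroʳ c)
  sum-*ˡ c f (x ∷ xs) = trans (cong (c * f x +_) (sum-*ˡ c f xs)) (sym (*-distribˡ-+ c (f x) _))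

  count : {P : A → Set} (P? : Decidable P) (xs : List A) →
          length (filter P? xs) ≡ sum (map (ind ∘ does ∘ P?) xs)
  count P? []       = refl
  count P? (x ∷ xs) with does (P? x)
  ... | true  = cong suc (count P? xs)
  ... | false = count P? xs

sum-cartesianProductWith : ∀ {A C E : Set} (h : E → ℕ) (_·_ : A → C → E) xs ys →
  sum (map h (cartesianProductWith _·_ xs ys)) ≡ sum (map (λ x → sum (map (λ y → h (x · y)) ys)) xs)
sum-cartesianProductWith h _·_ []       ys = refl
sum-cartesianProductWith h _·_ (x ∷ xs) ys = begin
  sum (map h (map (x ·_) ys ++ cartesianProductWith _·_ xs ys))                  ≡⟨ cong sum (map-++ h (map (x ·_) ys) _) ⟩
  sum (map h (map (x ·_) ys) ++ map h (cartesianProductWith _·_ xs ys))          ≡⟨ sum-++ (map h (map (x ·_) ys)) _ ⟩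
  sum (map h (map (x ·_) ys)) + sum (map h (cartesianProductWith _·_ xs ys))     ≡⟨ cong₂ _+_ (cong sum (sym (map-∘ ys))) (sum-cartesianProductWith h _·_ xs ys) ⟩
  _ ∎
  where open ≡-Reasoning

ind-∧ : ∀ s t → ind (s ∧ t) ≡ ind s * ind t
ind-∧ true  t = sym (+-identityʳ (ind t))
ind-∧ false t = refl

ind-cong : {P Q : Set} (P? : Dec P) (Q? : Dec Q) → (P → Q) → (Q → P) → ind (does P?) ≡ ind (does Q?)
ind-cong P? Q? f g = cong ind (does-⇔ (mk⇔ f g) P? Q?)

ind-yes : {P : Set} (P? : Dec P) → P → ind (does P?) ≡ 1
ind-yes P? p = cong ind (dec-true P? p)

ind-no : {P : Set} (P? : Dec P) → ¬ P → ind (does P?) ≡ 0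
ind-no P? ¬p = cong ind (dec-false P? ¬p)

sum-replicate-1 : ∀ {A : Set} (xs : List A) → sum (map (λ _ → 1) xs) ≡ length xs
sum-replicate-1 []       = refl
sum-replicate-1 (x ∷ xs) = cong suc (sum-replicate-1 xs)

sum≡0⇒ : ∀ {A : Set} {f : A → ℕ} {xs : List A} → sum (map f xs) ≡ 0 → ∀ {x} → x ∈ xs → f x ≡ 0
sum≡0⇒ {f = f} {y ∷ ys} eq (here refl) = m+n≡0⇒m≡0 (f y) eq
sum≡0⇒ {f = f} {y ∷ ys} eq (there x∈)  = sum≡0⇒ (m+n≡0⇒n≡0 (f y) eq) x∈

ind≡0⇒ : {P : Set} (P? : Dec P) → ind (does P?) ≡ 0 → ¬ P
ind≡0⇒ (no ¬p) _ = ¬p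

tabulate-applyUpTo : ∀ {A : Set} (f : ℕ → A) n → tabulate (λ i → f (toℕ {n} i)) ≡ applyUpTo f n
tabulate-applyUpTo f zero    = refl
tabulate-applyUpTo f (suc n) = cong (f 0 ∷_) (tabulate-applyUpTo (f ∘ suc) n)

sum-1⋯ : (f : ℕ → ℕ) (n : ℕ) → sum (map (λ x → f (suc (toℕ x))) (allFin n)) ≡ sum (map f (1⋯ n))
sum-1⋯ f n = cong sum (trans (map-tabulate (λ i → i) (λ x → f (suc (toℕ x))))
  (trans (tabulate-applyUpTo (f ∘ suc) n) (sym (map-applyUpTo suc f n))))

does-true : {P : Set} (P? : Dec P) → does P? ≡ true → P
does-true (yes p) _ = p

-- Distances

-- The inequality `k ≤ ∣ i - j ∣` split by the order of the two places and free of subtraction, so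
-- that it can be chained with other inequalities.
Sep : ℕ → ℕ → ℕ → Set
Sep k i j = k + i ≤ j ⊎ k + j ≤ i

Sep⇒≤ : ∀ {k i j} → Sep k i j → k ≤ ∣ i - j ∣
Sep⇒≤ {k} {i} {j} (inj₁ p) = ≤-trans (m+n≤o⇒m≤o∸n k p) (≤-reflexive (sym (m≤n⇒∣m-n∣≡n∸m (≤-trans (m≤n+m i k) p))))
Sep⇒≤ {k} {i} {j} (inj₂ p) = ≤-trans (m+n≤o⇒m≤o∸n k p) (≤-reflexive (sym (m≤n⇒∣n-m∣≡n∸m (≤-trans (m≤n+m j k) p))))

Sep-∣-∣ : ∀ i j → (∣ i - j ∣ + i ≡ j) ⊎ (∣ i - j ∣ + j ≡ i)
Sep-∣-∣ i j with ≤-total i j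
... | inj₁ i≤j = inj₁ (trans (cong (_+ i) (m≤n⇒∣m-n∣≡n∸m i≤j)) (m∸n+n≡m i≤j))
... | inj₂ j≤i = inj₂ (trans (cong (_+ j) (m≤n⇒∣n-m∣≡n∸m j≤i)) (m∸n+n≡m j≤i))

∣-∣-from-+ : ∀ {k i j} → k + i ≡ j → ∣ i - j ∣ ≡ k
∣-∣-from-+ {k} {i} refl = trans (cong (∣ i -_∣) (+-comm k i)) (∣m-m+n∣≡n i k)

≤⇒Sep : ∀ {k i j} → k ≤ ∣ i - j ∣ → Sep k i j
≤⇒Sep {k} {i} {j} k≤ with Sep-∣-∣ i j
... | inj₁ eq = inj₁ (≤-trans (+-monoˡ-≤ i k≤) (≤-reflexive eq))
... | inj₂ eq = inj₂ (≤-trans (+-monoˡ-≤ j k≤) (≤-reflexive eq))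

module _ {p : ℕ} where

  distance-∷⁺ : (x : Fin p) (occ : Occupied p) (y : Fin p) →
                distance (x ∷⁺ occ) y ≡ ∣ toℕ y - toℕ x ∣ ⊓ distance occ y
  distance-∷⁺ x (_ ∷ _) y = refl

  toList-∷⁺ : (x : Fin p) (occ : Occupied p) → toList (x ∷⁺ occ) ≡ x ∷ toList occ
  toList-∷⁺ x (_ ∷ _) = refl

  ∈-distance : (occ : Occupied p) (y : Fin p) {z : Fin p} → z ∈ toList occ → distance occ y ≤ ∣ toℕ y - toℕ z ∣
  ∈-distance (z ∷ [])      y (here refl) = ≤-refl
  ∈-distance (z ∷ z₁ ∷ zs) y (here refl) = m⊓n≤m _ _
  ∈-distance (z ∷ z₁ ∷ zs) y (there z∈)  = ≤-trans (m⊓n≤n _ _) (∈-distance (z₁ ∷ zs) y z∈)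

  distance-attained : (occ : Occupied p) (y : Fin p) →
                      ∃ λ z → z ∈ toList occ × distance occ y ≡ ∣ toℕ y - toℕ z ∣
  distance-attained (z ∷ zs) y = attained z zs
    where
    attained : ∀ z zs → ∃ λ w → w ∈ z ∷ zs × distance (z ∷ zs) y ≡ ∣ toℕ y - toℕ w ∣
    attained z []        = z , here refl , refl
    attained z (z₁ ∷ zs) with attained z₁ zs | ⊓-sel ∣ toℕ y - toℕ z ∣ (distance (z₁ ∷ zs) y)
    ... | _            | inj₁ eq = z , here refl , eq
    ... | w , w∈ , eq′ | inj₂ eq = w , there w∈ , trans eq eq′

  nearest : (occ : Occupied p) (y : Fin p) {k : ℕ} → distance occ y ≡ k →
            ∃ λ z → z ∈ toList occ × ((k + toℕ y ≡ toℕ z) ⊎ (k + toℕ z ≡ toℕ y))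
  nearest occ y refl with z , z∈ , eq ← distance-attained occ y =
    z , z∈ , subst (λ k → (k + toℕ y ≡ toℕ z) ⊎ (k + toℕ z ≡ toℕ y)) (sym eq) (Sep-∣-∣ (toℕ y) (toℕ z))

  separated : (occ : Occupied p) {y z : Fin p} {k : ℕ} → k ≤ distance occ y → z ∈ toList occ → Sep k (toℕ y) (toℕ z)
  separated occ {y} k≤ z∈ = ≤⇒Sep (≤-trans k≤ (∈-distance occ y z∈))

  distance-greatest : (occ : Occupied p) {y : Fin p} {k : ℕ} →
                      (∀ {z} → z ∈ toList occ → Sep k (toℕ y) (toℕ z)) → k ≤ distance occ y
  distance-greatest occ {y} sep with z , z∈ , eq ← distance-attained occ y =
    ≤-trans (Sep⇒≤ (sep z∈)) (≤-reflexive (sym eq))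

  occupied⇒0 : (occ : Occupied p) {y : Fin p} → y ∈ toList occ → distance occ y ≡ 0
  occupied⇒0 occ {y} y∈ = n≤0⇒n≡0 (≤-trans (∈-distance occ y y∈) (≤-reflexive (∣n-n∣≡0 (toℕ y))))

  positive⇒empty : (occ : Occupied p) {y : Fin p} → 1 ≤ distance occ y → Empty occ y
  positive⇒empty occ 1≤ y∈ = 1+n≰n (≤-trans 1≤ (≤-reflexive (occupied⇒0 occ y∈)))

  empty⇒positive : (occ : Occupied p) {y : Fin p} → Empty occ y → 1 ≤ distance occ y
  empty⇒positive occ {y} e = n≢0⇒n>0 λ eq → e (at-0 eq)
    where
    at-0 : distance occ y ≡ 0 → y ∈ toList occ
    at-0 eq with nearest occ y eq
    ... | z , z∈ , inj₁ y≡z = subst (_∈ toList occ) (toℕ-injective (sym y≡z)) z∈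
    ... | z , z∈ , inj₂ z≡y = subst (_∈ toList occ) (toℕ-injective z≡y) z∈

  Max : Occupied p → ℕ → Set
  Max occ k = ∀ v → distance occ v ≤ k

  polite⇒max : (occ : Occupied p) {x : Fin p} → PoliteChoice occ x → Max occ (distance occ x)
  polite⇒max occ (_ , max) v with empty? occ v
  ... | yes e = max v e
  ... | no ¬e = ≤-trans (≮⇒≥ (λ 0<d → ¬e (positive⇒empty occ 0<d))) z≤n

  module _ (occ : Occupied p) (x : Fin p) where

    distance-decreases : ∀ y → distance (x ∷⁺ occ) y ≤ distance occ y
    distance-decreases y = ≤-trans (≤-reflexive (distance-∷⁺ x occ y)) (m⊓n≤n _ _)

    x∈x∷⁺ : x ∈ toList (x ∷⁺ occ)
    x∈x∷⁺ = subst (x ∈_) (sym (toList-∷⁺ x occ)) (here refl)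

    distance-self : distance (x ∷⁺ occ) x ≡ 0
    distance-self = occupied⇒0 (x ∷⁺ occ) x∈x∷⁺

    distance-kept : ∀ {y k} → Sep k (toℕ y) (toℕ x) → distance occ y ≡ k → distance (x ∷⁺ occ) y ≡ k
    distance-kept {y} {k} sep eq = ≤-antisym
      (≤-trans (distance-decreases y) (≤-reflexive eq))
      (≤-trans (⊓-glb (Sep⇒≤ sep) (≤-reflexive (sym eq))) (≤-reflexive (sym (distance-∷⁺ x occ y))))

  Adj : Fin p → Fin p → Set
  Adj u v = suc (toℕ u) ≡ toℕ v ⊎ suc (toℕ v) ≡ toℕ u

  adj? : ∀ u v → Dec (Adj u v)
  adj? u v with suc (toℕ u) ≟ toℕ v | suc (toℕ v) ≟ toℕ u
  ... | yes e | _     = yes (inj₁ e)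
  ... | no _  | yes e = yes (inj₂ e)
  ... | no ¬e | no ¬f = no [ ¬e , ¬f ]′

  -- Two empty neighbours at distance 1 both get chosen at distance 1, so only
  -- distances from 2 on count.
  Paired : Occupied p → Fin p → Set
  Paired occ y = 2 ≤ distance occ y × ∃ λ y′ → Adj y y′ × distance occ y′ ≡ distance occ y

  paired? : ∀ occ y → Dec (Paired occ y)
  paired? occ y = (2 ≤? distance occ y) ×-dec Fin.any? (λ y′ → adj? y y′ ×-dec (distance occ y′ ≟ distance occ y))

  -- An occupied place `k` steps to the right of `u` would be only `k - 1` steps from `v`, so the
  -- nearest occupied place of `u` is on its left.
  pair-left-end : (occ : Occupied p) {u v : Fin p} {k : ℕ} → suc (toℕ u) ≡ toℕ v → 1 ≤ k →
                  distance occ u ≡ k → distance occ v ≡ k →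
                  ∃ λ z → z ∈ toList occ × k + toℕ z ≡ toℕ u
  pair-left-end occ {u} {v} {k} uv 1≤k du dv with nearest occ u du
  ... | z , z∈ , inj₂ eq = z , z∈ , eq
  ... | z , z∈ , inj₁ eq with separated occ {v} {z} (≤-reflexive (sym dv)) z∈
  ...   | inj₁ le = contradiction (≤-trans le (≤-reflexive (sym eq)))
                      (<⇒≱ (+-monoʳ-< k (≤-reflexive uv)))
  ...   | inj₂ le = contradiction le (<⇒≱ (begin-strict
            toℕ v            ≡⟨ sym uv ⟩
            1 + toℕ u        ≤⟨ +-monoˡ-≤ (toℕ u) 1≤k ⟩
            k + toℕ u        ≡⟨ eq ⟩
            toℕ z            <⟨ +-monoˡ-≤ (toℕ z) 1≤k ⟩
            k + toℕ z        ∎))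
    where open ≤-Reasoning

  -- Mirror image of `pair-left-end`.
  pair-right-end : (occ : Occupied p) {u v : Fin p} {k : ℕ} → suc (toℕ u) ≡ toℕ v → 1 ≤ k →
                   distance occ u ≡ k → distance occ v ≡ k →
                   ∃ λ z → z ∈ toList occ × k + toℕ v ≡ toℕ z
  pair-right-end occ {u} {v} {k} uv 1≤k du dv with nearest occ v dv
  ... | z , z∈ , inj₁ eq = z , z∈ , eq
  ... | z , z∈ , inj₂ eq with separated occ {u} {z} (≤-reflexive (sym du)) z∈
  ...   | inj₂ le = contradiction (≤-trans (≤-reflexive (trans uv (sym eq))) le) 1+n≰n
  ...   | inj₁ le = contradiction le (<⇒≱ (begin-strict
            toℕ z            ≤⟨ ≤-pred (begin
                                  suc (toℕ z) ≤⟨ +-monoˡ-≤ (toℕ z) 1≤k ⟩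
                                  k + toℕ z   ≡⟨ trans eq (sym uv) ⟩
                                  suc (toℕ u) ∎) ⟩
            toℕ u            <⟨ +-monoˡ-≤ (toℕ u) 1≤k ⟩
            k + toℕ u        ∎))
    where open ≤-Reasoning

  -- The pair `v`, `w` has an occupied place `k` steps to the left of `v`, and that place is only
  -- `k - 1` steps from `u`.
  no-triple : (occ : Occupied p) {u v w : Fin p} {k : ℕ} → 1 ≤ k →
              suc (toℕ u) ≡ toℕ v → suc (toℕ v) ≡ toℕ w →
              distance occ u ≡ k → distance occ v ≡ k → distance occ w ≡ k → ⊥
  no-triple occ {u} {v} {w} {k} 1≤k uv vw du dv dw
    with z , z∈ , eq ← pair-left-end occ vw 1≤k dv dw
    with separated occ {u} {z} (≤-reflexive (sym du)) z∈
  ... | inj₂ le = 1+n≰n (≤-trans (≤-reflexive (trans uv (sym eq))) le)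
  ... | inj₁ le = 1+n≰n (begin
          suc (toℕ z) ≤⟨ +-monoˡ-≤ (toℕ z) 1≤k ⟩
          k + toℕ z   ≡⟨ trans eq (sym uv) ⟩
          1 + toℕ u   ≤⟨ +-monoˡ-≤ (toℕ u) 1≤k ⟩
          k + toℕ u   ≤⟨ le ⟩
          toℕ z       ∎)
    where open ≤-Reasoning

  adj-unique : (occ : Occupied p) {u v w : Fin p} {k : ℕ} → 1 ≤ k → Adj v u → Adj v w →
               distance occ u ≡ k → distance occ v ≡ k → distance occ w ≡ k → u ≡ w
  adj-unique occ 1≤k (inj₁ a) (inj₁ b) du dv dw = toℕ-injective (trans (sym a) b)
  adj-unique occ 1≤k (inj₂ a) (inj₂ b) du dv dw = toℕ-injective (suc-injective (trans a (sym b)))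
  adj-unique occ 1≤k (inj₁ a) (inj₂ b) du dv dw = ⊥-elim (no-triple occ 1≤k b a dw dv du)
  adj-unique occ 1≤k (inj₂ a) (inj₁ b) du dv dw = ⊥-elim (no-triple occ 1≤k a b du dv dw)

  -- The pair is enclosed by occupied places exactly `k` steps outside it. Between these only `u`
  -- and `v` are `k` steps away from both, so `x` lies outside and at least `k` steps beyond one of
  -- them.
  pair-kept : (occ : Occupied p) {u v x : Fin p} {k : ℕ} → 1 ≤ k → suc (toℕ u) ≡ toℕ v →
              distance occ u ≡ k → distance occ v ≡ k → k ≤ distance occ x → x ≢ u → x ≢ v →
              Sep k (toℕ u) (toℕ x) × Sep k (toℕ v) (toℕ x)
  pair-kept occ {u} {v} {x} {k} 1≤k uv du dv k≤dx x≢u x≢v with <-cmp (toℕ x) (toℕ u)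
  ... | tri≈ _ eq _ = ⊥-elim (x≢u (toℕ-injective eq))
  ... | tri< x<u _ _
    with z , z∈ , eq ← pair-left-end occ uv 1≤k du dv
    with separated occ k≤dx z∈
  ...   | inj₂ le = ⊥-elim (<⇒≱ x<u (≤-trans (≤-reflexive (sym eq)) le))
  ...   | inj₁ le = inj₂ le′ , inj₂ (≤-trans le′ (≤-trans (n≤1+n _) (≤-reflexive uv)))
    where
    le′ : k + toℕ x ≤ toℕ u
    le′ = ≤-trans le (≤-trans (m≤n+m _ k) (≤-reflexive eq))
  pair-kept occ {u} {v} {x} {k} 1≤k uv du dv k≤dx x≢u x≢v | tri> _ _ u<x
    with z , z∈ , eq ← pair-right-end occ uv 1≤k du dv
    with separated occ k≤dx z∈
  ...   | inj₁ le = ⊥-elim (x≢v (toℕ-injective (≤-antisym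
                      (+-cancelˡ-≤ k _ _ (≤-trans le (≤-reflexive (sym eq))))
                      (≤-trans (≤-reflexive (sym uv)) u<x))))
  ...   | inj₂ le = inj₁ (≤-trans (+-monoʳ-≤ k (≤-trans (n≤1+n _) (≤-reflexive uv))) le′) , inj₁ le′
    where
    le′ : k + toℕ v ≤ toℕ x
    le′ = ≤-trans (≤-reflexive eq) (≤-trans (m≤n+m _ k) le)

  -- If neither alternative holds, no occupied place lies between `x` and `y`, and moving one step
  -- from `x` towards `y` reaches a place of distance greater than `k`.
  max-apart-< : (occ : Occupied p) {x y : Fin p} {k : ℕ} → Max occ k →
                distance occ x ≡ k → distance occ y ≡ k → toℕ x < toℕ y →
                suc (toℕ x) ≡ toℕ y ⊎ k + toℕ x ≤ toℕ y
  max-apart-< occ {x} {y} {k} max dx dy x<y with suc (toℕ x) ≟ toℕ y | k + toℕ x ≤? toℕ y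
  ... | yes e | _      = inj₁ e
  ... | no _  | yes le = inj₂ le
  ... | no ¬e | no ¬le = ⊥-elim (1+n≰n (≤-trans (distance-greatest occ sep) (max v)))
    where
    x+2≤y : suc (suc (toℕ x)) ≤ toℕ y
    x+2≤y = ≤∧≢⇒< x<y ¬e
    -- The right neighbour of `x`; it still lies strictly before `y`.
    v : Fin p
    v = fromℕ< (<-trans x+2≤y (toℕ<n y))
    v≡ : toℕ v ≡ suc (toℕ x)
    v≡ = toℕ-fromℕ< _
    sep : ∀ {z} → z ∈ toList occ → Sep (suc k) (toℕ v) (toℕ z)
    sep {z} z∈ rewrite v≡ with separated occ {x} (≤-reflexive (sym dx)) z∈
    ... | inj₂ le = inj₂ (s≤s le)
    ... | inj₁ le with separated occ {y} (≤-reflexive (sym dy)) z∈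
    ...   | inj₂ le′ = ⊥-elim (¬le (≤-trans le (≤-trans (m≤n+m _ k) le′)))
    ...   | inj₁ le′ = inj₁ (≤-trans (≤-reflexive (sym (+-suc k (suc (toℕ x))))) (≤-trans (+-monoʳ-≤ k x+2≤y) le′))

  max-apart : (occ : Occupied p) {x y : Fin p} {k : ℕ} → Max occ k →
              distance occ x ≡ k → distance occ y ≡ k → y ≢ x → Adj y x ⊎ Sep k (toℕ y) (toℕ x)
  max-apart occ {x} {y} max dx dy y≢x with <-cmp (toℕ x) (toℕ y)
  ... | tri≈ _ eq _ = ⊥-elim (y≢x (toℕ-injective (sym eq)))
  ... | tri< lt _ _ = [ inj₁ ∘ inj₂ , inj₂ ∘ inj₂ ]′ (max-apart-< occ max dx dy lt)
  ... | tri> _ _ gt = [ inj₁ ∘ inj₁ , inj₂ ∘ inj₁ ]′ (max-apart-< occ max dy dx gt)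

-- Gaps

data End : Set where
  wall taken : End

-- A left run ends inside the row, or reaches its left edge: there the run goes on
-- for c further places, beyond which l is found.
data LeftRun {m} (o : Fin m → Bool) (x : Fin m) (l : End) (c : ℕ) : End → ℕ → Set where
  inside  : ∀ {n} u → o u ≡ true → suc n + toℕ u ≡ toℕ x →
            (∀ v → o v ≡ true → toℕ v ≤ toℕ u ⊎ toℕ x ≤ toℕ v) → LeftRun o x l c taken n
  outside : (∀ v → o v ≡ true → toℕ x ≤ toℕ v) → LeftRun o x l c l (c + toℕ x)

data RightRun {m} (o : Fin m → Bool) (x : Fin m) : End → ℕ → Set where
  inside  : ∀ {n} v → o v ≡ true → suc n + toℕ x ≡ toℕ v →
            (∀ w → o w ≡ true → toℕ w ≤ toℕ x ⊎ toℕ v ≤ toℕ w) → RightRun o x taken n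
  outside : ∀ {n} → suc n + toℕ x ≡ m → (∀ w → o w ≡ true → toℕ w ≤ toℕ x) → RightRun o x wall n

data InitialRun {m} (o : Fin m → Bool) : End → ℕ → Set where
  inside  : ∀ v → o v ≡ true → (∀ w → o w ≡ true → toℕ v ≤ toℕ w) → InitialRun o taken (toℕ v)
  outside : (∀ w → o w ≡ false) → InitialRun o wall m

initial⇒right : ∀ {m} {o : Fin (suc m) → Bool} {r n} → InitialRun (o ∘ sucF) r n → RightRun o 0F r n
initial⇒right (inside v ov before) = inside (sucF v) ov (cong suc (+-identityʳ _)) λ where
  0F       _  → inj₁ z≤n
  (sucF w) ow → inj₂ (s≤s (before w ow))
initial⇒right (outside none) = outside (cong suc (+-identityʳ _)) λ where
  0F       _  → z≤n
  (sucF w) ow → contradiction (trans (sym ow) (none w)) λ ()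

right-suc : ∀ {m} {o : Fin (suc m) → Bool} {x r n} → RightRun (o ∘ sucF) x r n → RightRun o (sucF x) r n
right-suc {x = x} {n = n} (inside v ov eq gap) = inside (sucF v) ov (cong suc (trans (+-suc n _) eq)) λ where
  0F       _  → inj₁ z≤n
  (sucF w) ow → [ inj₁ ∘ s≤s , inj₂ ∘ s≤s ]′ (gap w ow)
right-suc {n = n} (outside eq gap) = outside (cong suc (trans (+-suc n _) eq)) λ where
  0F       _  → z≤n
  (sucF w) ow → s≤s (gap w ow)

left-suc-taken : ∀ {m} {o : Fin (suc m) → Bool} {x l c l′ n} → o 0F ≡ true →
                 LeftRun (o ∘ sucF) x taken 0 l′ n → LeftRun o (sucF x) l c l′ n
left-suc-taken {n = n} o0 (inside u ou eq gap) = inside (sucF u) ou (cong suc (trans (+-suc n _) eq)) λ where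
  0F       _  → inj₁ z≤n
  (sucF w) ow → [ inj₁ ∘ s≤s , inj₂ ∘ s≤s ]′ (gap w ow)
left-suc-taken o0 (outside gap) = inside 0F o0 (cong suc (+-identityʳ _)) λ where
  0F       _  → inj₁ z≤n
  (sucF w) ow → inj₂ (s≤s (gap w ow))

left-suc-empty : ∀ {m} {o : Fin (suc m) → Bool} {x l c l′ n} → o 0F ≡ false →
                 LeftRun (o ∘ sucF) x l (suc c) l′ n → LeftRun o (sucF x) l c l′ n
left-suc-empty {n = n} o0 (inside u ou eq gap) = inside (sucF u) ou (cong suc (trans (+-suc n _) eq)) λ where
  0F       _  → inj₁ z≤n
  (sucF w) ow → [ inj₁ ∘ s≤s , inj₂ ∘ s≤s ]′ (gap w ow)
left-suc-empty {x = x} {l} {c} o0 (outside gap) = subst (LeftRun _ _ l c l) (+-suc c (toℕ x)) (outside λ where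
  0F       ow → contradiction (trans (sym ow) o0) λ ()
  (sucF w) ow → s≤s (gap w ow))

-- For a gap of length `suc g` between occupied ends: the middle consists of two places exactly if
-- the two halves of `g` differ, and its distance `suc ⌊ g /2⌋` is at least 2 exactly if the first
-- test succeeds.
middlePaired : ℕ → Bool
middlePaired g = does (1 ≤? ⌊ g /2⌋) ∧ not (does (⌊ g /2⌋ ≟ ⌈ g /2⌉))

-- The sum of a statistic e of (distance, paired) over all persons that will still
-- arrive, computed gap by gap: the first person in a gap of length suc g with two
-- occupied ends sits in its middle, leaving gaps of lengths ⌊ g /2⌋ and ⌈ g /2⌉; in a
-- gap at the edge of the row the first person sits at the edge.
module Statistic (e : ℕ → Bool → ℕ) where

  -- The first argument is fuel for the recursion on halves. Fuel at least the length of the gap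
  -- suffices, so the default 0 in the second clause is not reached from `inner`.
  innerWithin : ℕ → ℕ → ℕ
  innerWithin _       zero    = 0
  innerWithin zero    (suc g) = 0
  innerWithin (suc f) (suc g) =
    e (suc ⌊ g /2⌋) (middlePaired g) + (innerWithin f ⌊ g /2⌋ + innerWithin f ⌈ g /2⌉)

  innerWithin-fuel : ∀ {f f′} g → g ≤ f → g ≤ f′ → innerWithin f g ≡ innerWithin f′ g
  innerWithin-fuel zero    _         _          = refl
  innerWithin-fuel (suc g) (s≤s g≤f) (s≤s g≤f′) = cong (e (suc ⌊ g /2⌋) (middlePaired g) +_) (cong₂ _+_
    (innerWithin-fuel ⌊ g /2⌋ (≤-trans (⌊n/2⌋≤n g) g≤f) (≤-trans (⌊n/2⌋≤n g) g≤f′))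
    (innerWithin-fuel ⌈ g /2⌉ (≤-trans (⌈n/2⌉≤n g) g≤f) (≤-trans (⌈n/2⌉≤n g) g≤f′)))

  inner : ℕ → ℕ
  inner g = innerWithin g g

  inner-suc : ∀ g → inner (suc g) ≡ e (suc ⌊ g /2⌋) (middlePaired g) + (inner ⌊ g /2⌋ + inner ⌈ g /2⌉)
  inner-suc g = cong (e (suc ⌊ g /2⌋) (middlePaired g) +_) (cong₂ _+_
    (innerWithin-fuel ⌊ g /2⌋ (⌊n/2⌋≤n g) ≤-refl)
    (innerWithin-fuel ⌈ g /2⌉ (⌈n/2⌉≤n g) ≤-refl))

  -- The recursion at `g = n + n`: a single middle place, hence never paired.
  inner-even-split : ∀ n → inner (n + suc n) ≡ e (suc n) false + (inner n + inner n)
  inner-even-split n rewrite +-suc n n | inner-suc (n + n) | sym (n≡⌊n+n/2⌋ n) | sym (n≡⌈n+n/2⌉ n)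
    | dec-true (n ≟ n) refl | ∧-zeroʳ (does (1 ≤? n)) = refl

  -- The recursion at `g = suc (n + n)`: two middle places at distance `suc n`, which form a counted
  -- pair once that distance is at least 2.
  inner-odd-split : ∀ n → inner (suc n + suc n) ≡ e (suc n) (does (1 ≤? n)) + (inner n + inner (suc n))
  inner-odd-split n rewrite +-suc n n | inner-suc (suc (n + n)) | sym (n≡⌊n+n/2⌋ n) | sym (n≡⌈n+n/2⌉ n)
    | dec-false (n ≟ suc n) (<⇒≢ (n<1+n n)) | ∧-identityʳ (does (1 ≤? n)) = refl

  outer : ℕ → ℕ
  outer zero    = 0
  outer (suc g) = e (suc g) false + inner g

  -- The value for an empty row is never used.
  ofGap : End → End → ℕ → ℕ
  ofGap taken taken g = inner g
  ofGap taken wall  g = outer g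
  ofGap wall  taken g = outer g
  ofGap wall  wall  g = 0

  -- Reads the row o from the left, after c empty places that follow the end l.
  ofRow : ∀ {m} → (Fin m → Bool) → End → ℕ → ℕ
  ofRow {zero}  o l c = ofGap l wall c
  ofRow {suc m} o l c = if o 0F then ofGap l taken c + ofRow (o ∘ sucF) taken 0
                                else ofRow (o ∘ sucF) l (suc c)

  ofRow-cong : ∀ {m} {o o′ : Fin m → Bool} → (∀ y → o y ≡ o′ y) → ∀ l c → ofRow o l c ≡ ofRow o′ l c
  ofRow-cong {zero}  eq l c = refl
  ofRow-cong {suc m} {o} {o′} eq l c rewrite eq 0F with o′ 0F
  ... | true  = cong (ofGap l taken c +_) (ofRow-cong (eq ∘ sucF) taken 0)
  ... | false = ofRow-cong (eq ∘ sucF) l (suc c)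

  -- Isolates the first gap of the row. That `rest` does not depend on `l` and `c` lets one
  -- decomposition serve for the row before and after its left end has been changed.
  initial-run : ∀ {m} (o : Fin m → Bool) → ∃ λ r → ∃ λ n → InitialRun o r n ×
                ∃ λ rest → ∀ l c → ofRow o l c ≡ ofGap l r (c + n) + rest
  initial-run {zero}  o = wall , 0 , outside (λ ()) , 0 , λ l c →
    trans (cong (ofGap l wall) (sym (+-identityʳ c))) (sym (+-identityʳ _))
  initial-run {suc m} o with o 0F in o0
  ... | true  = taken , 0 , inside 0F o0 (λ _ _ → z≤n) , ofRow (o ∘ sucF) taken 0 , λ l c →
    cong (λ n → ofGap l taken n + _) (sym (+-identityʳ c))
  ... | false with initial-run (o ∘ sucF)
  ...   | .taken , _ , inside v ov before , rest , eq =
    taken , _ , inside (sucF v) ov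
      (λ where 0F ow → contradiction (trans (sym ow) o0) λ ()
               (sucF w) ow → s≤s (before w ow)) ,
    rest , λ l c → trans (eq l (suc c)) (cong (λ n → ofGap l taken n + rest) (sym (+-suc c _)))
  ...   | .wall , _ , outside none , rest , eq =
    wall , _ , outside (λ where 0F → o0
                                (sucF w) → none w) ,
    rest , λ l c → trans (eq l (suc c)) (cong (λ n → ofGap l wall n + rest) (sym (+-suc c _)))

  -- Taking `x` affects only the gap that contains it; `rest` collects all other gaps and is shared
  -- by both rows.
  record Split {m} (o o′ : Fin m → Bool) (x : Fin m) (l : End) (c : ℕ) : Set where
    field
      {leftEnd rightEnd} : End
      {left right}       : ℕ
      leftRun  : LeftRun o x l c leftEnd left
      rightRun : RightRun o x rightEnd right
      rest     : ℕ
      before   : ofRow o l c ≡ ofGap leftEnd rightEnd (left + suc right) + rest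
      after    : ofRow o′ l c ≡ (ofGap leftEnd taken left + ofGap taken rightEnd right) + rest

  split : ∀ {m} (o o′ : Fin m → Bool) (x : Fin m) → o x ≡ false → o′ x ≡ true →
          (∀ y → y ≢ x → o′ y ≡ o y) → ∀ l c → Split o o′ x l c
  split {suc m} o o′ 0F ox o′x same l c with initial-run (o ∘ sucF)
  ... | r , n , run , rest , eq = record
    { leftRun  = outside (λ _ _ → z≤n)
    ; rightRun = initial⇒right run
    ; rest     = rest
    ; before   = before
    ; after    = after
    }
    where
    before : ofRow o l c ≡ ofGap l r (c + 0 + suc n) + rest
    before rewrite ox = trans (eq l (suc c))
      (cong (λ k → ofGap l r k + rest) (trans (sym (+-suc c n)) (cong (_+ suc n) (sym (+-identityʳ c)))))
    after : ofRow o′ l c ≡ (ofGap l taken (c + 0) + ofGap taken r n) + rest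
    after rewrite o′x | +-identityʳ c = trans
      (cong (ofGap l taken c +_) (trans (ofRow-cong (λ y → same (sucF y) λ ()) taken 0) (eq taken 0)))
      (sym (+-assoc (ofGap l taken c) _ rest))
  split {suc m} o o′ (sucF x) ox o′x same l c with o 0F in o0
  ... | true  = record
    { leftRun  = left-suc-taken o0 S.leftRun
    ; rightRun = right-suc S.rightRun
    -- The gap that closes at the taken place `0F` lies to the left of the gap of `x` and is
    -- therefore unaffected.
    ; rest     = ofGap l taken c + S.rest
    ; before   = before
    ; after    = after
    }
    where
    module S = Split (split (o ∘ sucF) (o′ ∘ sucF) x ox o′x (λ y y≢x → same (sucF y) (y≢x ∘ Fin.suc-injective)) taken 0)
    +-exchange : ∀ i j k → i + (j + k) ≡ j + (i + k)
    +-exchange i j k = trans (sym (+-assoc i j k)) (trans (cong (_+ k) (+-comm i j)) (+-assoc j i k))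
    before : ofRow o l c ≡ ofGap S.leftEnd S.rightEnd (S.left + suc S.right) + (ofGap l taken c + S.rest)
    before rewrite o0 = trans (cong (ofGap l taken c +_) S.before) (+-exchange (ofGap l taken c) _ S.rest)
    after : ofRow o′ l c ≡ (ofGap S.leftEnd taken S.left + ofGap taken S.rightEnd S.right) + (ofGap l taken c + S.rest)
    after rewrite trans (same 0F λ ()) o0 = trans (cong (ofGap l taken c +_) S.after) (+-exchange (ofGap l taken c) _ S.rest)
  ... | false = record
    { leftRun  = left-suc-empty o0 S.leftRun
    ; rightRun = right-suc S.rightRun
    ; rest     = S.rest
    ; before   = before
    ; after    = after
    }
    where
    module S = Split (split (o ∘ sucF) (o′ ∘ sucF) x ox o′x (λ y y≢x → same (sucF y) (y≢x ∘ Fin.suc-injective)) l (suc c))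
    before : ofRow o l c ≡ ofGap S.leftEnd S.rightEnd (S.left + suc S.right) + S.rest
    before rewrite o0 = S.before
    after : ofRow o′ l c ≡ (ofGap S.leftEnd taken S.left + ofGap taken S.rightEnd S.right) + S.rest
    after rewrite trans (same 0F λ ()) o0 = S.after

  row : ∀ {p} → Occupied p → Fin p → Bool
  row occ y = does (memberDec _≟F_ y (toList occ))

  total : ∀ {p} → Occupied p → ℕ
  total occ = ofRow (row occ) wall 0

  ofRow-full : ∀ {m} {o : Fin m → Bool} → (∀ y → o y ≡ true) → ∀ l → ofRow o l 0 ≡ 0
  ofRow-full {zero}  all taken = refl
  ofRow-full {zero}  all wall  = refl
  ofRow-full {suc m} all l rewrite all 0F = cong₂ _+_ (ofGap-0 l) (ofRow-full (all ∘ sucF) taken)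
    where
    ofGap-0 : ∀ l → ofGap l taken 0 ≡ 0
    ofGap-0 taken = refl
    ofGap-0 wall  = refl

  total-full : ∀ {p} (occ : Occupied p) → (∀ y → y ∈ toList occ) → total occ ≡ 0
  total-full occ all = ofRow-full (λ y → dec-true (memberDec _≟F_ y (toList occ)) (all y)) wall

  ofRow-none : ∀ {m} {o : Fin m → Bool} → (∀ y → o y ≡ false) → ∀ l c → ofRow o l c ≡ ofGap l wall (c + m)
  ofRow-none {zero}  none l c = cong (ofGap l wall) (sym (+-identityʳ c))
  ofRow-none {suc m} none l c rewrite none 0F =
    trans (ofRow-none (none ∘ sucF) l (suc c)) (cong (ofGap l wall) (sym (+-suc c m)))

  ofRow-single : ∀ {m} {o : Fin m → Bool} x → o x ≡ true → (∀ y → y ≢ x → o y ≡ false) → ∀ c →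
                 ofRow o wall c ≡ outer (c + toℕ x) + outer (m ∸ suc (toℕ x))
  ofRow-single {suc m} 0F ox off c rewrite ox | +-identityʳ c =
    cong (outer c +_) (ofRow-none (λ y → off (sucF y) λ ()) taken 0)
  ofRow-single {suc m} (sucF x) ox off c rewrite off 0F (λ ()) =
    trans (ofRow-single x ox (λ y y≢x → off (sucF y) (y≢x ∘ Fin.suc-injective)) (suc c))
          (cong (λ n → outer n + outer (m ∸ suc (toℕ x))) (sym (+-suc c (toℕ x))))

  total-single : ∀ {p} (x : Fin p) → total (x ∷ []) ≡ outer (toℕ x) + outer (p ∸ suc (toℕ x))
  total-single x = ofRow-single x
    (dec-true (memberDec _≟F_ x (x ∷ [])) (here refl))
    (λ y y≢x → dec-false (memberDec _≟F_ y (x ∷ [])) λ where (here eq) → y≢x eq)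
    0

-- Distances inside a single gap

at : ∀ {p n} → n < p → ∃ λ (y : Fin p) → toℕ y ≡ n
at n<p = fromℕ< n<p , toℕ-fromℕ< n<p

module _ {p} (occ : Occupied p) where

  from-left : {u y : Fin p} {i : ℕ} → u ∈ toList occ → i + toℕ u ≡ toℕ y → distance occ y ≤ i
  from-left {u} {y} u∈ eq = ≤-trans (∈-distance occ y u∈)
    (≤-reflexive (trans (∣-∣-comm (toℕ y) (toℕ u)) (∣-∣-from-+ eq)))

  from-right : {v y : Fin p} {j : ℕ} → v ∈ toList occ → j + toℕ y ≡ toℕ v → distance occ y ≤ j
  from-right {v} {y} v∈ eq = ≤-trans (∈-distance occ y v∈) (≤-reflexive (∣-∣-from-+ eq))

  distance-in-gap : {u v : Fin p} → u ∈ toList occ → v ∈ toList occ →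
                    (∀ z → z ∈ toList occ → toℕ z ≤ toℕ u ⊎ toℕ v ≤ toℕ z) →
                    ∀ {y i j} → i + toℕ u ≡ toℕ y → j + toℕ y ≡ toℕ v → distance occ y ≡ i ⊓ j
  distance-in-gap u∈ v∈ gap {y} {i} {j} iy jy = ≤-antisym
    (⊓-glb (from-left u∈ iy) (from-right v∈ jy))
    (distance-greatest occ λ {z} z∈ → [ (λ z≤u → inj₂ (≤-trans (+-mono-≤ (m⊓n≤m i j) z≤u) (≤-reflexive iy)))
                                      , (λ v≤z → inj₁ (≤-trans (+-monoˡ-≤ (toℕ y) (m⊓n≤n i j)) (≤-trans (≤-reflexive jy) v≤z)))
                                      ]′ (gap z z∈))

  distance-left-edge : {v : Fin p} → v ∈ toList occ → (∀ z → z ∈ toList occ → toℕ v ≤ toℕ z) →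
                       ∀ {y j} → j + toℕ y ≡ toℕ v → distance occ y ≡ j
  distance-left-edge v∈ first jy = ≤-antisym (from-right v∈ jy)
    (distance-greatest occ λ {z} z∈ → inj₁ (≤-trans (≤-reflexive jy) (first z z∈)))

  distance-right-edge : {u : Fin p} → u ∈ toList occ → (∀ z → z ∈ toList occ → toℕ z ≤ toℕ u) →
                        ∀ {y i} → i + toℕ u ≡ toℕ y → distance occ y ≡ i
  distance-right-edge u∈ last {i = i} iy = ≤-antisym (from-left u∈ iy)
    (distance-greatest occ λ {z} z∈ → inj₂ (≤-trans (+-monoʳ-≤ i (last z z∈)) (≤-reflexive iy)))

-- The effect of one polite choice on a statistic

module Step (e : ℕ → Bool → ℕ) where
  open Statistic e

  module _ {p} (occ : Occupied p) {x : Fin p} (max : Max occ (distance occ x)) where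

    Contribution : End → ℕ → End → ℕ → Set
    Contribution l a r b = ofGap l r (a + suc b) ≡
      e (distance occ x) (does (paired? occ x)) + (ofGap l taken a + ofGap taken r b)

    contribution : ∀ l a r b {k q} → distance occ x ≡ k → does (paired? occ x) ≡ q →
                   ofGap l r (a + suc b) ≡ e k q + (ofGap l taken a + ofGap taken r b) → Contribution l a r b
    contribution l a r b dx px eq =
      trans eq (cong₂ (λ k q → e k q + (ofGap l taken a + ofGap taken r b)) (sym dx) (sym px))

    -- Maximality forces `a` and `b` to differ by at most one. If they are equal, `x` is the only
    -- middle place; if they differ by one, the neighbour of `x` on the longer side is the other
    -- middle place.
    interior : ∀ {u v} a b → u ∈ toList occ → v ∈ toList occ →
               (∀ z → z ∈ toList occ → toℕ z ≤ toℕ u ⊎ toℕ v ≤ toℕ z) →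
               suc a + toℕ u ≡ toℕ x → suc b + toℕ x ≡ toℕ v → Contribution taken a taken b
    interior {u} {v} a b u∈ v∈ gap ax bx = cases (compare a b) refl refl
      where
      dx : distance occ x ≡ suc (a ⊓ b)
      dx = distance-in-gap occ u∈ v∈ gap ax bx
      before : ∀ y → suc (toℕ y) ≡ toℕ x → distance occ y ≡ a ⊓ suc (suc b)
      before y yx = distance-in-gap occ u∈ v∈ gap (suc-injective (trans ax (sym yx)))
        (trans (sym (cong suc (+-suc b (toℕ y)))) (trans (cong (suc b +_) yx) bx))
      after : ∀ y → suc (toℕ x) ≡ toℕ y → distance occ y ≡ suc (suc a) ⊓ b
      after y xy = distance-in-gap occ u∈ v∈ gap (trans (cong suc ax) xy)
        (trans (cong (b +_) (sym xy)) (trans (+-suc b (toℕ x)) bx))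
      previous : ∃ λ y → suc (toℕ y) ≡ toℕ x
      previous with y , eq ← at {p} {a + toℕ u} (<-trans (≤-reflexive ax) (toℕ<n x)) = y , trans (cong suc eq) ax
      next : ∃ λ y → suc (toℕ x) ≡ toℕ y
      next with y , eq ← at {p} {suc (toℕ x)} (≤-<-trans (s≤s (m≤n+m (toℕ x) b)) (≤-<-trans (≤-reflexive bx) (toℕ<n v))) = y , sym eq
      cases : ∀ {a′ b′} → Ordering a′ b′ → a′ ≡ a → b′ ≡ b → Contribution taken a taken b
      cases (equal _) refl refl = contribution taken a taken a (trans dx (cong suc (⊓-idem a)))
        (dec-false (paired? occ x) λ where
          (_ , y , inj₁ xy , eq) → <⇒≢ (≤-<-trans (m⊓n≤n (suc (suc a)) a) (≤-reflexive (cong suc (sym (⊓-idem a))))) (trans (sym (after y xy)) (trans eq dx))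
          (_ , y , inj₂ yx , eq) → <⇒≢ (≤-<-trans (m⊓n≤m a (suc (suc a))) (≤-reflexive (cong suc (sym (⊓-idem a))))) (trans (sym (before y yx)) (trans eq dx)))
        (inner-even-split a)
      -- Here `b` is at least `a + 2`, so the right neighbour of `x` would have a larger distance
      -- than `x`.
      cases (less _ (suc k)) refl refl with y , xy ← next = ⊥-elim (1+n≰n (begin
        suc (suc a)                         ≤⟨ ⊓-glb ≤-refl (s≤s (≤-trans (s≤s (m≤m+n a k)) (≤-reflexive (sym (+-suc a k))))) ⟩
        suc (suc a) ⊓ suc (a + suc k)       ≡⟨ after y xy ⟨
        distance occ y                      ≤⟨ max y ⟩
        distance occ x                      ≡⟨ dx ⟩
        suc (a ⊓ suc (a + suc k))           ≤⟨ s≤s (m⊓n≤m a _) ⟩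
        suc a                               ∎))
        where open ≤-Reasoning
      cases (less _ zero) refl refl with y , xy ← next | eq ← +-identityʳ a = contribution taken a taken b dx′
        (does-⇔ (mk⇔ (λ (2≤ , _) → ≤-pred (≤-trans 2≤ (≤-reflexive dx′)))
                     (λ 1≤a → ≤-trans (s≤s 1≤a) (≤-reflexive (sym dx′)) , y , inj₁ xy , trans (after y xy) (trans dy (sym dx′))))
                (paired? occ x) (1 ≤? a))
        (subst (λ b → inner (a + suc (suc b)) ≡ e (suc a) (does (1 ≤? a)) + (inner a + inner (suc b))) (sym eq)
          (trans (cong inner (+-suc a (suc a))) (inner-odd-split a)))
        where
        dx′ : distance occ x ≡ suc a
        dx′ = trans dx (cong suc (m≤n⇒m⊓n≡m (≤-trans (m≤m+n a 0) (n≤1+n _))))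
        dy : suc (suc a) ⊓ suc (a + 0) ≡ suc a
        dy = trans (m≥n⇒m⊓n≡n (s≤s (≤-trans (≤-reflexive (+-identityʳ a)) (n≤1+n a)))) (cong suc (+-identityʳ a))
      cases (greater _ (suc k)) refl refl with y , yx ← previous = ⊥-elim (1+n≰n (begin
        suc (suc b)                         ≤⟨ ⊓-glb (s≤s (≤-trans (s≤s (m≤m+n b k)) (≤-reflexive (sym (+-suc b k))))) ≤-refl ⟩
        suc (b + suc k) ⊓ suc (suc b)       ≡⟨ before y yx ⟨
        distance occ y                      ≤⟨ max y ⟩
        distance occ x                      ≡⟨ dx ⟩
        suc (suc (b + suc k) ⊓ b)           ≤⟨ s≤s (m⊓n≤n _ b) ⟩
        suc b                               ∎))
        where open ≤-Reasoning
      cases (greater _ zero) refl refl with y , yx ← previous | eq ← +-identityʳ b = contribution taken a taken b dx′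
        (does-⇔ (mk⇔ (λ (2≤ , _) → ≤-pred (≤-trans 2≤ (≤-reflexive dx′)))
                     (λ 1≤b → ≤-trans (s≤s 1≤b) (≤-reflexive (sym dx′)) , y , inj₂ yx , trans (before y yx) (trans dy (sym dx′))))
                (paired? occ x) (1 ≤? b))
        (subst (λ a → inner (suc a + suc b) ≡ e (suc b) (does (1 ≤? b)) + (inner (suc a) + inner b)) (sym eq)
          (trans (inner-odd-split b) (cong (e (suc b) (does (1 ≤? b)) +_) (+-comm (inner b) _))))
        where
        dx′ : distance occ x ≡ suc b
        dx′ = trans dx (cong suc (m≥n⇒m⊓n≡n (≤-trans (m≤m+n b 0) (n≤1+n _))))
        dy : suc (b + 0) ⊓ suc (suc b) ≡ suc b
        dy = trans (m≤n⇒m⊓n≡m (s≤s (≤-trans (≤-reflexive (+-identityʳ b)) (n≤1+n b)))) (cong suc (+-identityʳ b))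

    -- In an edge gap the distance grows towards the wall, so maximality puts `x` at the very edge.
    -- Its only neighbour has a smaller distance, hence `x` is not paired.
    left-edge : ∀ {v a} b → v ∈ toList occ → (∀ z → z ∈ toList occ → toℕ v ≤ toℕ z) →
                a ≡ toℕ x → suc b + toℕ x ≡ toℕ v → Contribution wall a taken b
    left-edge {v} {suc a} b v∈ first ax bx
      with y , eq ← at {p} {a} (<-trans (≤-reflexive ax) (toℕ<n x)) = ⊥-elim (1+n≰n (begin
        suc (suc b)     ≡⟨ distance-left-edge occ v∈ first
                             (trans (sym (cong suc (+-suc b (toℕ y)))) (trans (cong (suc b +_) (trans (cong suc eq) ax)) bx)) ⟨
        distance occ y  ≤⟨ max y ⟩
        distance occ x  ≡⟨ distance-left-edge occ v∈ first bx ⟩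
        suc b           ∎))
      where open ≤-Reasoning
    left-edge {v} {zero} b v∈ first ax bx = contribution wall 0 taken b dx
      (dec-false (paired? occ x) λ where
        (_ , y , inj₁ xy , eq) → 1+n≢n (trans (sym dx) (trans (sym eq)
          (distance-left-edge occ v∈ first (trans (cong (b +_) (sym xy)) (trans (+-suc b (toℕ x)) bx)))))
        (_ , y , inj₂ yx , eq) → 0≢1+n (trans ax (sym yx)))
      refl
      where
      dx : distance occ x ≡ suc b
      dx = distance-left-edge occ v∈ first bx

    -- Mirror image of `left-edge`.
    right-edge : ∀ {u b} a → u ∈ toList occ → (∀ z → z ∈ toList occ → toℕ z ≤ toℕ u) →
                 suc a + toℕ u ≡ toℕ x → suc b + toℕ x ≡ p → Contribution taken a wall b
    right-edge {u} {suc b} a u∈ last ax bx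
      with y , eq ← at {p} {suc (toℕ x)} (≤-trans (s≤s (s≤s (m≤n+m (toℕ x) b))) (≤-reflexive bx)) = ⊥-elim (1+n≰n (begin
        suc (suc a)     ≡⟨ distance-right-edge occ u∈ last (trans (cong suc ax) (sym eq)) ⟨
        distance occ y  ≤⟨ max y ⟩
        distance occ x  ≡⟨ distance-right-edge occ u∈ last ax ⟩
        suc a           ∎))
      where open ≤-Reasoning
    right-edge {u} {zero} a u∈ last ax bx = contribution taken a wall 0 dx
      (dec-false (paired? occ x) λ where
        (_ , y , inj₁ xy , eq) → 1+n≰n (≤-trans (s≤s (≤-trans (≤-reflexive (sym bx)) (≤-reflexive xy))) (toℕ<n y))
        (_ , y , inj₂ yx , eq) → 1+n≢n (trans (sym dx) (trans (sym eq)
          (distance-right-edge occ u∈ last (suc-injective (trans ax (sym yx)))))))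
      (trans (cong outer (trans (+-suc a 0) (cong suc (+-identityʳ a))))
             (cong (e (suc a) false +_) (sym (+-identityʳ (inner a)))))
      where
      dx : distance occ x ≡ suc a
      dx = distance-right-edge occ u∈ last ax

    row⇒∈ : ∀ v → row occ v ≡ true → v ∈ toList occ
    row⇒∈ v = does-true (memberDec _≟F_ v (toList occ))

    ∈⇒row : ∀ {v} → v ∈ toList occ → row occ v ≡ true
    ∈⇒row {v} = dec-true (memberDec _≟F_ v (toList occ))

    -- `split` reduces the claim to the gap of `x`, whose possible shapes are treated by `interior`,
    -- `left-edge` and `right-edge`.
    total-step : Empty occ x → total occ ≡ e (distance occ x) (does (paired? occ x)) + total (x ∷⁺ occ)
    total-step empty = trans S.before (trans (cong (_+ S.rest) (gap S.leftRun S.rightRun))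
      (trans (+-assoc (e _ _) _ S.rest) (cong (e (distance occ x) (does (paired? occ x)) +_) (sym S.after))))
      where
      same : ∀ y → y ≢ x → row (x ∷⁺ occ) y ≡ row occ y
      same y y≢x = does-⇔ (mk⇔ (λ y∈ → old (subst (y ∈_) (toList-∷⁺ x occ) y∈))
                               (λ y∈ → subst (y ∈_) (sym (toList-∷⁺ x occ)) (there y∈)))
                          (memberDec _≟F_ y (toList (x ∷⁺ occ))) (memberDec _≟F_ y (toList occ))
        where
        old : y ∈ x ∷ toList occ → y ∈ toList occ
        old (here y≡x) = contradiction y≡x y≢x
        old (there y∈) = y∈
      module S = Split (split (row occ) (row (x ∷⁺ occ)) x
        (dec-false (memberDec _≟F_ x (toList occ)) empty)
        (dec-true (memberDec _≟F_ x (toList (x ∷⁺ occ))) (x∈x∷⁺ occ x)) same wall 0)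
      gap : ∀ {l a r b} → LeftRun (row occ) x wall 0 l a → RightRun (row occ) x r b → Contribution l a r b
      gap {a = a} {b = b} (inside u ou au near) (inside v ov bv near′) =
        interior a b (row⇒∈ u ou) (row⇒∈ v ov) (λ z z∈ → between (near z (∈⇒row z∈)) (near′ z (∈⇒row z∈)) z∈) au bv
        where
        between : ∀ {z} → toℕ z ≤ toℕ u ⊎ toℕ x ≤ toℕ z → toℕ z ≤ toℕ x ⊎ toℕ v ≤ toℕ z → z ∈ toList occ → toℕ z ≤ toℕ u ⊎ toℕ v ≤ toℕ z
        between (inj₁ z≤u) _          _  = inj₁ z≤u
        between (inj₂ _)   (inj₂ v≤z) _  = inj₂ v≤z
        between (inj₂ x≤z) (inj₁ z≤x) z∈ = ⊥-elim (empty (subst (_∈ toList occ) (toℕ-injective (≤-antisym z≤x x≤z)) z∈))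
      gap {b = b} (outside near) (inside v ov bv near′) =
        left-edge b (row⇒∈ v ov) (λ z z∈ → first (near z (∈⇒row z∈)) (near′ z (∈⇒row z∈)) z∈) refl bv
        where
        first : ∀ {z} → toℕ x ≤ toℕ z → toℕ z ≤ toℕ x ⊎ toℕ v ≤ toℕ z → z ∈ toList occ → toℕ v ≤ toℕ z
        first _   (inj₂ v≤z) _  = v≤z
        first x≤z (inj₁ z≤x) z∈ = ⊥-elim (empty (subst (_∈ toList occ) (toℕ-injective (≤-antisym z≤x x≤z)) z∈))
      gap {a = a} (inside u ou au near) (outside bx near′) =
        right-edge a (row⇒∈ u ou) (λ z z∈ → last (near z (∈⇒row z∈)) (near′ z (∈⇒row z∈)) z∈) au bx
        where
        last : ∀ {z} → toℕ z ≤ toℕ u ⊎ toℕ x ≤ toℕ z → toℕ z ≤ toℕ x → z ∈ toList occ → toℕ z ≤ toℕ u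
        last (inj₁ z≤u) _   _  = z≤u
        last (inj₂ x≤z) z≤x z∈ = ⊥-elim (empty (subst (_∈ toList occ) (toℕ-injective (≤-antisym z≤x x≤z)) z∈))
      -- A gap with two walls would mean that the row is empty: the nearest occupied place `h` would
      -- have to coincide with `x`.
      gap (outside near) (outside _ near′) = ⊥-elim (empty (subst (_∈ toList occ)
        (toℕ-injective (≤-antisym (near′ h (∈⇒row h∈)) (near h (∈⇒row h∈)))) h∈))
        where
        h = proj₁ (distance-attained occ x)
        h∈ = proj₁ (proj₂ (distance-attained occ x))

-- Choices and pairs still to come in a partly filled row

choices : ℕ → ℕ → Bool → ℕ
choices j k _ = ind (does (k ≟ j))

-- A pair of neighbours is counted at the person who is the first to take one of its two places.
pairs : ℕ → ℕ → Bool → ℕ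
pairs j k q = ind (does (k ≟ j) ∧ q)

B D : ∀ {p} → Occupied p → ℕ → ℕ
B occ j = Statistic.total (choices j) occ
D occ j = Statistic.total (pairs j) occ

module _ {p : ℕ} where

  emptyCount : Occupied p → ℕ
  emptyCount occ = sum (map (λ x → ind (does (empty? occ x))) (allFin p))

  -- The first count provides a next polite choice as long as somebody is still to come; the second
  -- shows that the row is full once nobody is.
  record Remaining (occ : Occupied p) (m : ℕ) : Set where
    constructor remaining
    field
      arrived : length (toList occ) + m ≡ p
      empties : emptyCount occ ≡ m

  remaining-step : ∀ {occ : Occupied p} {m x} → Remaining occ (suc m) → Empty occ x → Remaining (x ∷⁺ occ) m
  remaining-step {occ} {m} {x} (remaining arrived empties) empty = remaining
    (trans (cong (λ l → length l + m) (toList-∷⁺ x occ)) (trans (sym (+-suc _ m)) arrived))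
    (suc-injective (trans (sym one-fewer) empties))
    where
    one-fewer : emptyCount occ ≡ 1 + emptyCount (x ∷⁺ occ)
    one-fewer = fold-change-at +-0-isCommutativeMonoid 1 (allFin⁺ p) (∈-allFin x)
      (trans (ind-yes (empty? occ x) empty) (cong suc (sym (ind-no (empty? (x ∷⁺ occ) x) (λ e → e (x∈x∷⁺ occ x))))))
      λ y y≢x → ind-cong (empty? occ y) (empty? (x ∷⁺ occ) y)
        (λ e y∈ → [ y≢x , e ]′ (new y (subst (y ∈_) (toList-∷⁺ x occ) y∈)))
        (λ e y∈ → e (subst (y ∈_) (sym (toList-∷⁺ x occ)) (there y∈)))
      where
      new : ∀ y → y ∈ x ∷ toList occ → y ≡ x ⊎ y ∈ toList occ
      new y (here eq)  = inj₁ eq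
      new y (there y∈) = inj₂ y∈

  remaining-0 : ∀ {occ : Occupied p} → Remaining occ 0 → ∀ y → y ∈ toList occ
  remaining-0 {occ} (remaining _ empties) y with memberDec _≟F_ y (toList occ)
  ... | yes y∈ = y∈
  ... | no y∉  = contradiction y∉ (ind≡0⇒ (empty? occ y) (sum≡0⇒ empties (∈-allFin y)))

  remaining⇒choice : ∀ {occ : Occupied p} {m} → Remaining occ (suc m) → ∃ (PoliteChoice occ)
  remaining⇒choice {occ} (remaining arrived _) =
    somePoliteChoice occ (subst (length (toList occ) <_) arrived (m<m+n _ z<s))

remaining-first : ∀ {m} (x : Fin (suc m)) → Remaining (x ∷ []) m
remaining-first {m} x = remaining refl (suc-injective (trans (sym one-fewer)
  (trans (sum-replicate-1 (allFin (suc m))) (length-tabulate (λ i → i)))))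
  where
  one-fewer : sum (map (λ _ → 1) (allFin (suc m))) ≡ 1 + emptyCount (x ∷ [])
  one-fewer = fold-change-at +-0-isCommutativeMonoid 1 (allFin⁺ _) (∈-allFin x)
    (cong suc (sym (ind-no (empty? (x ∷ []) x) (λ e → e (here refl)))))
    λ y y≢x → sym (ind-yes (empty? (x ∷ []) y) λ where (here eq) → y≢x eq)

adj-sym : ∀ {p} {u v : Fin p} → Adj u v → Adj v u
adj-sym = swap

adj-sep-1 : ∀ {p} {u v : Fin p} → Adj u v → Sep 1 (toℕ u) (toℕ v)
adj-sep-1 = [ inj₁ ∘ ≤-reflexive , inj₂ ∘ ≤-reflexive ]′

adj-close : ∀ {p} {u v : Fin p} → Adj u v → ∣ toℕ u - toℕ v ∣ ≡ 1
adj-close {u = u} {v} (inj₁ eq) = ∣-∣-from-+ eq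
adj-close {u = u} {v} (inj₂ eq) = trans (∣-∣-comm (toℕ u) (toℕ v)) (∣-∣-from-+ eq)

adj-not-sep : ∀ {p k} {u v : Fin p} → 2 ≤ k → Adj u v → ¬ Sep k (toℕ u) (toℕ v)
adj-not-sep 2≤k adj sep = <⇒≱ 2≤k (≤-trans (Sep⇒≤ sep) (≤-reflexive (adj-close adj)))

-- Counting polite completions

-- An unpaired place counts 2 and a paired one 1, so that each person who will sit at
-- distance k contributes 2.
weightOf : Bool → Bool → ℕ
weightOf false _     = 0
weightOf true  true  = 1
weightOf true  false = 2

module _ {p : ℕ} (k : ℕ) where

  weight : Occupied p → Fin p → ℕ
  weight occ y = weightOf (does (distance occ y ≟ k)) (does (paired? occ y))

  weight-far : ∀ occ y → distance occ y ≢ k → weight occ y ≡ 0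
  weight-far occ y dy = cong (λ t → weightOf t (does (paired? occ y))) (dec-false (distance occ y ≟ k) dy)

  weight-paired : ∀ occ y → distance occ y ≡ k → Paired occ y → weight occ y ≡ 1
  weight-paired occ y dy py = cong₂ weightOf (dec-true (distance occ y ≟ k) dy) (dec-true (paired? occ y) py)

  weight-unpaired : ∀ occ y → distance occ y ≡ k → ¬ Paired occ y → weight occ y ≡ 2
  weight-unpaired occ y dy py = cong₂ weightOf (dec-true (distance occ y ≟ k) dy) (dec-false (paired? occ y) py)

  totalWeight : Occupied p → ℕ
  totalWeight occ = sum (map (weight occ) (allFin p))

  module _ (occ : Occupied p) {x : Fin p} (1≤k : 1 ≤ k) (max : Max occ k) (dx : distance occ x ≡ k) where

    still-far : ∀ y → distance (x ∷⁺ occ) y ≡ k → distance occ y ≡ k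
    still-far y eq = ≤-antisym (max y) (≤-trans (≤-reflexive (sym eq)) (distance-decreases occ x y))

    -- Distances only decrease and `k` is maximal, so no place newly reaches distance `k`. A partner
    -- of `y` is not adjacent to `x`, since it would then have two neighbours at distance `k`; so it
    -- keeps its distance as well.
    weight-kept : ∀ y → y ≢ x → (distance occ y ≡ k → Sep k (toℕ y) (toℕ x)) → weight occ y ≡ weight (x ∷⁺ occ) y
    weight-kept y y≢x sep with distance occ y ≟ k
    ... | no dy = trans (weight-far occ y dy) (sym (weight-far (x ∷⁺ occ) y (dy ∘ still-far y)))
    ... | yes dy = cong₂ weightOf
      (trans (dec-true (distance occ y ≟ k) dy) (sym (dec-true (distance (x ∷⁺ occ) y ≟ k) dy′)))
      (does-⇔ (mk⇔ to from) (paired? occ y) (paired? (x ∷⁺ occ) y))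
      where
      dy′ : distance (x ∷⁺ occ) y ≡ k
      dy′ = distance-kept occ x (sep dy) dy
      to : Paired occ y → Paired (x ∷⁺ occ) y
      to (2≤ , z , adj , eq) = subst (2 ≤_) (trans dy (sym dy′)) 2≤ , z , adj , trans (distance-kept occ x z-sep dz) (sym dy′)
        where
        dz : distance occ z ≡ k
        dz = trans eq dy
        z≢x : z ≢ x
        z≢x refl = adj-not-sep (subst (2 ≤_) dy 2≤) adj (sep dy)
        z-sep : Sep k (toℕ z) (toℕ x)
        z-sep with max-apart occ max dx dz z≢x
        ... | inj₂ s    = s
        ... | inj₁ adj′ = contradiction (adj-unique occ 1≤k (adj-sym adj) adj′ dy dz dx) y≢x
      from : Paired (x ∷⁺ occ) y → Paired occ y
      from (2≤ , z , adj , eq) = ≤-trans 2≤ (distance-decreases occ x y) , z , adj , trans (still-far z (trans eq dy′)) (sym dy)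

    weight-self : weight (x ∷⁺ occ) x ≡ 0
    weight-self = weight-far (x ∷⁺ occ) x λ eq → <⇒≢ 1≤k (trans (sym (distance-self occ x)) eq)

    -- An unpaired `x` takes away its own weight 2. A paired `x` takes away 1 for itself and 1 for
    -- its partner, which drops to distance 1.
    totalWeight-step : totalWeight occ ≡ 2 + totalWeight (x ∷⁺ occ)
    totalWeight-step with paired? occ x
    ... | no unpaired = fold-change-at +-0-isCommutativeMonoid 2 (allFin⁺ p) (∈-allFin x)
      (trans (weight-unpaired occ x dx unpaired) (cong (2 +_) (sym weight-self)))
      λ y y≢x → weight-kept y y≢x (sep y y≢x)
      where
      sep : ∀ y → y ≢ x → distance occ y ≡ k → Sep k (toℕ y) (toℕ x)
      sep y y≢x dy with max-apart occ max dx dy y≢x | 2 ≤? k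
      ... | inj₂ s   | _       = s
      ... | inj₁ adj | yes 2≤k = contradiction (subst (2 ≤_) (sym dx) 2≤k , y , adj-sym adj , trans dy (sym dx)) unpaired
      -- Here `k` is 1, and a neighbour of `x` keeps distance 1.
      ... | inj₁ adj | no  2≰k = subst (λ k → Sep k (toℕ y) (toℕ x)) (≤-antisym 1≤k (≤-pred (≰⇒> 2≰k))) (adj-sep-1 adj)
    ... | yes (2≤ , z , adj , eq) = trans
      (fold-change-at +-0-isCommutativeMonoid 1 (allFin⁺ p) (∈-allFin x) at-x off-x)
      (cong suc (fold-change-at +-0-isCommutativeMonoid 1 (allFin⁺ p) (∈-allFin z) at-z off-z))
      where
      dz : distance occ z ≡ k
      dz = trans eq dx
      2≤k : 2 ≤ k
      2≤k = subst (2 ≤_) dx 2≤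
      z≢x : z ≢ x
      z≢x refl = [ 1+n≢n , 1+n≢n ]′ adj
      -- An intermediate weight, with `x` already removed and its partner `z` still counted: each
      -- half of the change then concerns a single place.
      middle : Fin p → ℕ
      middle y = if does (y ≟F x) then 0 else weight occ y
      middle-x : middle x ≡ 0
      middle-x = cong (if_then 0 else weight occ x) (dec-true (x ≟F x) refl)
      off-x : ∀ y → y ≢ x → weight occ y ≡ middle y
      off-x y y≢x = cong (if_then 0 else weight occ y) (sym (dec-false (y ≟F x) y≢x))
      at-x : weight occ x ≡ 1 + middle x
      at-x = trans (weight-paired occ x dx (2≤ , z , adj , eq)) (cong suc (sym middle-x))
      at-z : middle z ≡ 1 + weight (x ∷⁺ occ) z
      at-z = trans (sym (off-x z z≢x)) (trans
        (weight-paired occ z dz (subst (2 ≤_) (sym dz) 2≤k , x , adj-sym adj , sym eq))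
        (cong suc (sym (weight-far (x ∷⁺ occ) z λ dz′ → <⇒≱ 2≤k (≤-trans (≤-reflexive (sym dz′))
          (≤-trans (∈-distance (x ∷⁺ occ) z (x∈x∷⁺ occ x)) (≤-reflexive (adj-close (adj-sym adj)))))))))
      off-z : ∀ y → y ≢ z → middle y ≡ weight (x ∷⁺ occ) y
      off-z y y≢z with y ≟F x
      ... | yes refl = sym weight-self
      ... | no y≢x   = weight-kept y y≢x sep
        where
        sep : distance occ y ≡ k → Sep k (toℕ y) (toℕ x)
        sep dy with max-apart occ max dx dy y≢x
        ... | inj₂ s    = s
        ... | inj₁ adj′ = contradiction (adj-unique occ 1≤k (adj-sym adj′) adj dy dx dz) y≢z

B-step : ∀ {p} (occ : Occupied p) {x} j → PoliteChoice occ x →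
         B occ j ≡ ind (does (distance occ x ≟ j)) + B (x ∷⁺ occ) j
B-step occ j polite = Step.total-step (choices j) occ (polite⇒max occ polite) (proj₁ polite)

D-step : ∀ {p} (occ : Occupied p) {x} j → PoliteChoice occ x →
         D occ j ≡ ind (does (distance occ x ≟ j) ∧ does (paired? occ x)) + D (x ∷⁺ occ) j
D-step occ j polite = Step.total-step (pairs j) occ (polite⇒max occ polite) (proj₁ polite)

B-step-≡ : ∀ {p} (occ : Occupied p) {x j} → PoliteChoice occ x → distance occ x ≡ j →
           B occ j ≡ 1 + B (x ∷⁺ occ) j
B-step-≡ occ {x} {j} polite dx = trans (B-step occ j polite) (cong (_+ B (x ∷⁺ occ) j) (ind-yes (distance occ x ≟ j) dx))

B-step-≢ : ∀ {p} (occ : Occupied p) {x j} → PoliteChoice occ x → distance occ x ≢ j →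
           B occ j ≡ B (x ∷⁺ occ) j
B-step-≢ occ {x} {j} polite dx = trans (B-step occ j polite) (cong (_+ B (x ∷⁺ occ) j) (ind-no (distance occ x ≟ j) dx))

D-step-≡ : ∀ {p} (occ : Occupied p) {x j} → PoliteChoice occ x → distance occ x ≡ j →
           D occ j ≡ ind (does (paired? occ x)) + D (x ∷⁺ occ) j
D-step-≡ occ {x} {j} polite dx = trans (D-step occ j polite)
  (cong (λ t → ind (t ∧ does (paired? occ x)) + D (x ∷⁺ occ) j) (dec-true (distance occ x ≟ j) dx))

D-step-≢ : ∀ {p} (occ : Occupied p) {x j} → PoliteChoice occ x → distance occ x ≢ j →
           D occ j ≡ D (x ∷⁺ occ) j
D-step-≢ occ {x} {j} polite dx = trans (D-step occ j polite)
  (cong (λ t → ind (t ∧ does (paired? occ x)) + D (x ∷⁺ occ) j) (dec-false (distance occ x ≟ j) dx))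

-- Induction along some polite filling: both sides drop by 2 when a person sits at distance `k` and
-- stay the same otherwise. Only an upper bound `k` on the distances is assumed, so the induction
-- continues when distance `k` no longer occurs.
totalWeight≡2B : ∀ {p} m {k} (occ : Occupied p) → Remaining occ m → 1 ≤ k → Max occ k → totalWeight k occ ≡ 2 * B occ k
totalWeight≡2B zero {k} occ rem 1≤k max = trans
  (sum-zero (allFin _) λ y → weight-far k occ y λ eq → <⇒≢ 1≤k (trans (sym (occupied⇒0 occ (remaining-0 rem y))) eq))
  (cong (2 *_) (sym (Statistic.total-full (choices k) occ (remaining-0 rem))))
totalWeight≡2B (suc m) {k} occ rem 1≤k max with x , polite ← remaining⇒choice rem
  with IH ← totalWeight≡2B m {k} (x ∷⁺ occ) (remaining-step rem (proj₁ polite)) 1≤k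
              (λ v → ≤-trans (distance-decreases occ x v) (max v))
  with distance occ x ≟ k
... | yes dx = trans (totalWeight-step k occ 1≤k max dx) (trans (cong (2 +_) IH)
  (trans (sym (*-distribˡ-+ 2 1 (B (x ∷⁺ occ) k))) (cong (2 *_) (sym (B-step-≡ occ polite dx)))))
-- The polite choice `x` has distance below `k`, hence so has every place, and all weights are 0
-- before and after.
... | no dx = trans (sum-cong (allFin _) λ y → trans (weight-far k occ y (≠k y)) (sym (weight-far k (x ∷⁺ occ) y λ eq →
    ≠k y (≤-antisym (max y) (≤-trans (≤-reflexive (sym eq)) (distance-decreases occ x y))))))
  (trans IH (cong (2 *_) (sym (B-step-≢ occ polite dx))))
  where
  ≠k : ∀ y → distance occ y ≢ k
  ≠k y eq = dx (≤-antisym (max x) (≤-trans (≤-reflexive (sym eq)) (polite⇒max occ polite y)))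

∈-1⋯ : ∀ {n k} → 1 ≤ k → k ≤ n → k ∈ 1⋯ n
∈-1⋯ (s≤s z≤n) k≤n = ∈-applyUpTo⁺ suc k≤n

1⋯-unique : ∀ n → Unique (1⋯ n)
1⋯-unique n = applyUpTo⁺₁ suc n λ i<j _ → <⇒≢ i<j ∘ suc-injective

module _ {p : ℕ} where

  factor : Occupied p → ℕ → ℕ
  factor occ j = 2 ^ D occ j * (B occ j) !

  orders : Occupied p → ℕ
  orders occ = product (map (factor occ) (1⋯ (p ∸ 1)))

  -- Ensures that the product `orders` contains a factor for every distance at which somebody can
  -- sit.
  distance-bound : (occ : Occupied p) (x : Fin p) → distance occ x ≤ p ∸ 1
  distance-bound occ x with z , z∈ , _ ← distance-attained occ x =
    ≤-trans (∈-distance occ x z∈) (≤-trans (∣m-n∣≤m⊔n (toℕ x) (toℕ z)) (⊔-lub (below x) (below z)))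
    where
    below : ∀ {p} (y : Fin p) → toℕ y ≤ p ∸ 1
    below {suc p} y = ≤-pred (toℕ<n y)

  -- Only the factor for the distance of `x` changes: its factorial loses the top factor, and its
  -- power of 2 loses one factor exactly if `x` is paired.
  orders-step : (occ : Occupied p) {x : Fin p} {paired : Bool} → PoliteChoice occ x → does (paired? occ x) ≡ paired →
    orders occ ≡ (2 ^ ind paired * B occ (distance occ x)) * orders (x ∷⁺ occ)
  orders-step occ {x} {paired} polite px = fold-change-at *-1-isCommutativeMonoid (2 ^ q * B occ k) (1⋯-unique (p ∸ 1))
    (∈-1⋯ (empty⇒positive occ (proj₁ polite)) (distance-bound occ x)) at-k off
    where
    k = distance occ x
    q = ind paired
    B′ = B (x ∷⁺ occ) k
    D′ = D (x ∷⁺ occ) k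
    Bk : B occ k ≡ suc B′
    Bk = B-step-≡ occ polite refl
    Dk : D occ k ≡ q + D′
    Dk = trans (D-step-≡ occ polite refl) (cong (λ t → ind t + D′) px)
    at-k : factor occ k ≡ (2 ^ q * B occ k) * factor (x ∷⁺ occ) k
    at-k = begin
      2 ^ D occ k * (B occ k) !                ≡⟨ cong₂ (λ s t → 2 ^ s * t !) Dk Bk ⟩
      2 ^ (q + D′) * (suc B′ * B′ !)           ≡⟨ cong (_* (suc B′ * B′ !)) (^-distribˡ-+-* 2 q D′) ⟩
      (2 ^ q * 2 ^ D′) * (suc B′ * B′ !)       ≡⟨ [m*n]*[o*p]≡[m*o]*[n*p] (2 ^ q) (2 ^ D′) (suc B′) (B′ !) ⟩
      (2 ^ q * suc B′) * (2 ^ D′ * B′ !)       ≡⟨ cong (λ t → (2 ^ q * t) * (2 ^ D′ * B′ !)) Bk ⟨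
      (2 ^ q * B occ k) * (2 ^ D′ * B′ !)      ∎
      where open ≡-Reasoning
    off : ∀ j → j ≢ k → factor occ j ≡ factor (x ∷⁺ occ) j
    off j j≢k = cong₂ (λ s t → 2 ^ s * t !)
      (D-step-≢ occ polite (≢-sym j≢k)) (B-step-≢ occ polite (≢-sym j≢k))

  completions : ℕ → Occupied p → ℕ
  completions m occ = sum (map (λ xs → ind (does (politeAfter? occ xs))) (sequences p m))

  completions-suc : ∀ m occ → completions (suc m) occ ≡
    sum (map (λ x → ind (does (politeChoice? occ x)) * completions m (x ∷⁺ occ)) (allFin p))
  completions-suc m occ = trans (sum-cartesianProductWith _ _∷_ (allFin p) (sequences p m))
    (sum-cong (allFin p) λ x → trans
      (sum-cong (sequences p m) λ xs → ind-∧ (does (politeChoice? occ x)) (does (politeAfter? (x ∷⁺ occ) xs)))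
      (sum-*ˡ (ind (does (politeChoice? occ x))) _ (sequences p m)))

  orders-full : (occ : Occupied p) → (∀ y → y ∈ toList occ) → orders occ ≡ 1
  orders-full occ full = ones (1⋯ (p ∸ 1))
    where
    ones : ∀ js → product (map (factor occ) js) ≡ 1
    ones []       = refl
    ones (j ∷ js) = cong₂ _*_ (cong₂ (λ s t → 2 ^ s * t !)
      (Statistic.total-full (pairs j) occ full) (Statistic.total-full (choices j) occ full)) (ones js)

  -- Induction on the number of persons still to come. By `orders-step`, a polite choice accounts
  -- for the fraction weight over `2 * B occ k` of `orders occ`, and the weights add up to
  -- `2 * B occ k`. Multiplying by this number avoids division.
  completions≡orders : ∀ m occ → Remaining occ m → completions m occ ≡ orders occ
  completions≡orders zero    occ rem = sym (orders-full occ (remaining-0 rem))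
  completions≡orders (suc m) occ rem with x₀ , polite₀ ← remaining⇒choice rem =
    *-cancelˡ-≡ _ _ (2 * B occ k) (begin
      2 * B occ k * completions (suc m) occ                                    ≡⟨ cong (2 * B occ k *_) (completions-suc m occ) ⟩
      2 * B occ k * sum (map branch (allFin p))                                ≡⟨ sum-*ˡ (2 * B occ k) branch (allFin p) ⟨
      sum (map (λ x → 2 * B occ k * branch x) (allFin p))                      ≡⟨ sum-cong (allFin p) share ⟩
      sum (map (λ x → orders occ * weight k occ x) (allFin p))                 ≡⟨ sum-*ˡ (orders occ) (weight k occ) (allFin p) ⟩
      orders occ * totalWeight k occ                                           ≡⟨ *-comm (orders occ) _ ⟩
      totalWeight k occ * orders occ                                           ≡⟨ cong (_* orders occ) (totalWeight≡2B (suc m) occ rem 1≤k max) ⟩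
      2 * B occ k * orders occ                                                 ∎)
    where
    open ≡-Reasoning
    k = distance occ x₀
    max : Max occ k
    max = polite⇒max occ polite₀
    1≤k : 1 ≤ k
    1≤k = empty⇒positive occ (proj₁ polite₀)
    branch : Fin p → ℕ
    branch x = ind (does (politeChoice? occ x)) * completions m (x ∷⁺ occ)
    instance
      B-nonZero : NonZero (2 * B occ k)
      -- The polite choice `x₀` is itself one of the persons counted by `B occ k`.
      B-nonZero = m*n≢0 2 (B occ k) {{_}} {{≢-nonZero λ eq → 1+n≢0 (trans (sym (B-step-≡ occ polite₀ refl)) eq)}}
    impolite⇒0 : ∀ x → ¬ PoliteChoice occ x → branch x ≡ 0
    impolite⇒0 x impolite = cong (_* completions m (x ∷⁺ occ)) (ind-no (politeChoice? occ x) impolite)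
    polite⇒orders : ∀ x → PoliteChoice occ x → branch x ≡ orders (x ∷⁺ occ)
    polite⇒orders x polite = trans (cong (_* completions m (x ∷⁺ occ)) (ind-yes (politeChoice? occ x) polite))
      (trans (*-identityˡ _) (completions≡orders m (x ∷⁺ occ) (remaining-step rem (proj₁ polite))))
    share : ∀ x → 2 * B occ k * branch x ≡ orders occ * weight k occ x
    share x with politeChoice? occ x
    ... | no impolite = trans (trans (cong (2 * B occ k *_) (impolite⇒0 x impolite)) (*-zeroʳ (2 * B occ k))) (trans (sym (*-zeroʳ (orders occ)))
      (cong (orders occ *_) (sym (weight-far k occ x λ dx → impolite
        ( positive⇒empty occ (≤-trans 1≤k (≤-reflexive (sym dx)))
        , λ y _ → ≤-trans (max y) (≤-reflexive (sym dx)))))))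
    ... | yes polite with paired? occ x
    ...   | yes paired = begin
      2 * B occ k * branch x                                      ≡⟨ cong (2 * B occ k *_) (polite⇒orders x polite) ⟩
      2 * B occ k * orders (x ∷⁺ occ)                             ≡⟨ cong (λ j → 2 * B occ j * orders (x ∷⁺ occ)) dx ⟨
      2 * B occ (distance occ x) * orders (x ∷⁺ occ)              ≡⟨ orders-step occ polite (dec-true (paired? occ x) paired) ⟨
      orders occ                                                  ≡⟨ *-identityʳ _ ⟨
      orders occ * 1                                              ≡⟨ cong (orders occ *_) (weight-paired k occ x dx paired) ⟨
      orders occ * weight k occ x                                 ∎
      where
      dx = ≤-antisym (max x) (polite⇒max occ polite x₀)
    ...   | no unpaired = begin
      2 * B occ k * branch x                                      ≡⟨ cong (2 * B occ k *_) (polite⇒orders x polite) ⟩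
      2 * B occ k * orders (x ∷⁺ occ)                             ≡⟨ cong (λ j → 2 * B occ j * orders (x ∷⁺ occ)) dx ⟨
      2 * B occ (distance occ x) * orders (x ∷⁺ occ)              ≡⟨ *-assoc 2 (B occ (distance occ x)) _ ⟩
      2 * (B occ (distance occ x) * orders (x ∷⁺ occ))            ≡⟨ cong (λ t → 2 * (t * orders (x ∷⁺ occ))) (*-identityˡ (B occ (distance occ x))) ⟨
      2 * (1 * B occ (distance occ x) * orders (x ∷⁺ occ))        ≡⟨ cong (2 *_) (orders-step occ polite (dec-false (paired? occ x) unpaired)) ⟨
      2 * orders occ                                              ≡⟨ *-comm 2 (orders occ) ⟩
      orders occ * 2                                              ≡⟨ cong (orders occ *_) (weight-unpaired k occ x dx unpaired) ⟨
      orders occ * weight k occ x                                 ∎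
      where
      dx = ≤-antisym (max x) (polite⇒max occ polite x₀)

-- The numbers b and d

module _ {p : ℕ} where

  choices≡B : ∀ {m} k (occ : Occupied p) (xs : Vec (Fin p) m) → Remaining occ m → PoliteAfter occ xs →
              length (filter (_≟ k) (distancesAfter occ xs)) ≡ B occ k
  choices≡B k occ []       rem _                  = sym (Statistic.total-full (choices k) occ (remaining-0 rem))
  choices≡B k occ (x ∷ xs) rem (polite , polites)
    with IH ← choices≡B k (x ∷⁺ occ) xs (remaining-step rem (proj₁ polite)) polites = trans
    (count (_≟ k) (distancesAfter occ (x ∷ xs)))
    (trans (cong (ind (does (distance occ x ≟ k)) +_) (trans (sym (count (_≟ k) (distancesAfter (x ∷⁺ occ) xs))) IH))
    (sym (B-step occ k polite)))

  -- `EmptyPair` for a filling that continues from `occ`, as the induction over the persons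
  -- requires. The decision procedure below copies `emptyPair?`, so that both counts agree by
  -- computation.
  NeighboursEver : ∀ {m} → ℕ → Occupied p → Vec (Fin p) m → Fin p × Fin p → Set
  NeighboursEver k occ xs (u , v) = toℕ v ≡ suc (toℕ u) × Any (BothEmptyAt k u v) (statesAfter occ xs)

  neighboursEver? : ∀ {m} k occ (xs : Vec (Fin p) m) uv → Dec (NeighboursEver k occ xs uv)
  neighboursEver? k occ xs (u , v) = (toℕ v ≟ suc (toℕ u)) ×-dec
    any? (λ occ → (empty? occ u ×-dec (distance occ u ≟ k)) ×-dec (empty? occ v ×-dec (distance occ v ≟ k)))
         (statesAfter occ xs)

  neighbours : List (Fin p × Fin p)
  neighbours = cartesianProduct (allFin p) (allFin p)

  everCount : ∀ {m} → ℕ → Occupied p → Vec (Fin p) m → ℕ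
  everCount k occ xs = sum (map (λ uv → ind (does (neighboursEver? k occ xs uv))) neighbours)

  now : ∀ {m} {Q : Occupied p → Set} occ (xs : Vec (Fin p) m) → Q occ → Any Q (statesAfter occ xs)
  now occ []       q = here q
  now occ (x ∷ xs) q = here q

  never-again : ∀ {m k u v x} occ (xs : Vec (Fin p) m) → x ∈ toList occ →
                Any (BothEmptyAt k u v) (statesAfter occ xs) → x ≢ u × x ≢ v
  never-again occ []       x∈ (here ((eu , _) , ev , _)) = (λ where refl → eu x∈) , (λ where refl → ev x∈)
  never-again occ (y ∷ ys) x∈ (here ((eu , _) , ev , _)) = (λ where refl → eu x∈) , (λ where refl → ev x∈)
  never-again {x = x} occ (y ∷ ys) x∈ (there later) =
    never-again (y ∷⁺ occ) ys (subst (x ∈_) (sym (toList-∷⁺ y occ)) (there x∈)) later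

  both-kept : ∀ {k u v x} (occ : Occupied p) → 1 ≤ k → PoliteChoice occ x → toℕ v ≡ suc (toℕ u) → x ≢ u → x ≢ v →
              BothEmptyAt k u v occ → BothEmptyAt k u v (x ∷⁺ occ)
  both-kept {k} {u} {v} {x} occ 1≤k polite vu x≢u x≢v ((_ , du) , _ , dv) =
    let su , sv = pair-kept occ 1≤k (sym vu) du dv (≤-trans (≤-reflexive (sym du)) (polite⇒max occ polite u)) x≢u x≢v
    in kept u su du , kept v sv dv
    where
    kept : ∀ w → Sep k (toℕ w) (toℕ x) → distance occ w ≡ k → Empty (x ∷⁺ occ) w × distance (x ∷⁺ occ) w ≡ k
    kept w sep dw = positive⇒empty (x ∷⁺ occ) (≤-trans 1≤k (≤-reflexive (sym dw′))) , dw′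
      where dw′ = distance-kept occ x sep dw

  later : ∀ {m k x} occ (xs : Vec (Fin p) m) {uv} → NeighboursEver k (x ∷⁺ occ) xs uv → NeighboursEver k occ (x ∷ xs) uv
  later occ xs (vu , any) = vu , there any

  -- By `both-kept`, a pair present now is still present in the next state unless `x` takes one of
  -- its two places.
  earlier : ∀ {m k x} occ (xs : Vec (Fin p) m) u v → 1 ≤ k → PoliteChoice occ x → NeighboursEver k occ (x ∷ xs) (u , v) →
            NeighboursEver k (x ∷⁺ occ) xs (u , v) ⊎
            (toℕ v ≡ suc (toℕ u) × (x ≡ u ⊎ x ≡ v) × distance occ u ≡ k × distance occ v ≡ k)
  earlier occ xs u v 1≤k polite (vu , there any) = inj₁ (vu , any)
  earlier {x = x} occ xs u v 1≤k polite (vu , here both@((_ , du) , _ , dv)) with x ≟F u | x ≟F v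
  ... | yes x≡u | _       = inj₂ (vu , inj₁ x≡u , du , dv)
  ... | no _    | yes x≡v = inj₂ (vu , inj₂ x≡v , du , dv)
  ... | no x≢u  | no x≢v  = inj₁ (vu , now (x ∷⁺ occ) xs (both-kept occ 1≤k polite vu x≢u x≢v both))

  -- A polite choice `x` ends at most one pair, namely `x` with its unique neighbour at distance
  -- `k`; all other pairs survive into the next state. Hence the count changes exactly as in
  -- `D-step`.
  pairs≡D : ∀ {m} k (occ : Occupied p) (xs : Vec (Fin p) m) → 2 ≤ k → Remaining occ m → PoliteAfter occ xs →
            everCount k occ xs ≡ D occ k
  pairs≡D k occ [] 2≤k rem _ = trans
    (sum-zero neighbours λ (u , v) → ind-no (neighboursEver? k occ [] (u , v)) λ where (_ , here ((eu , _) , _)) → eu (remaining-0 rem u))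
    (sym (Statistic.total-full (pairs k) occ (remaining-0 rem)))
  pairs≡D k occ (x ∷ xs) 2≤k rem (polite , polites)
    with IH ← pairs≡D k (x ∷⁺ occ) xs 2≤k (remaining-step rem (proj₁ polite)) polites
    with distance occ x ≟ k | paired? occ x
  ... | no dx | _ = trans
    (sum-cong neighbours λ (u , v) → ind-cong (neighboursEver? k occ (x ∷ xs) (u , v)) (neighboursEver? k (x ∷⁺ occ) xs (u , v))
      ([ (λ ever → ever) , (λ where (_ , inj₁ refl , du , _) → contradiction du dx
                                    (_ , inj₂ refl , _ , dv) → contradiction dv dx) ]′ ∘ earlier occ xs u v (<⇒≤ 2≤k) polite)
      (later occ xs))
    (trans IH (sym (D-step-≢ occ polite dx)))
  ... | yes dx | no unpaired = trans
    (sum-cong neighbours λ (u , v) → ind-cong (neighboursEver? k occ (x ∷ xs) (u , v)) (neighboursEver? k (x ∷⁺ occ) xs (u , v))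
      ([ (λ ever → ever) , (λ where
           (vu , inj₁ refl , _ , dv) → contradiction (subst (2 ≤_) (sym dx) 2≤k , v , inj₁ (sym vu) , trans dv (sym dx)) unpaired
           (vu , inj₂ refl , du , _) → contradiction (subst (2 ≤_) (sym dx) 2≤k , u , inj₂ (sym vu) , trans du (sym dx)) unpaired)
       ]′ ∘ earlier occ xs u v (<⇒≤ 2≤k) polite)
      (later occ xs))
    (trans IH (sym (trans (D-step-≡ occ polite dx) (cong (_+ D (x ∷⁺ occ) k) (ind-no (paired? occ x) unpaired)))))
  ... | yes dx | yes paired@(_ , z , adj , dz′) = trans (one-fewer adj)
    (trans (cong suc IH) (sym (trans (D-step-≡ occ polite dx) (cong (_+ D (x ∷⁺ occ) k) (ind-yes (paired? occ x) paired)))))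
    where
    1≤k = <⇒≤ 2≤k
    dz : distance occ z ≡ k
    dz = trans dz′ dx
    Ever  = neighboursEver? k occ (x ∷ xs)
    Ever′ = neighboursEver? k (x ∷⁺ occ) xs
    at-k : ∀ {y} → distance occ y ≡ k → Empty occ y × distance occ y ≡ k
    at-k dy = positive⇒empty occ (≤-trans 1≤k (≤-reflexive (sym dy))) , dy
    off : ∀ uv → (∀ {u v} → toℕ v ≡ suc (toℕ u) → x ≡ u ⊎ x ≡ v → distance occ u ≡ k → distance occ v ≡ k → uv ≢ (u , v)) →
          ind (does (Ever uv)) ≡ ind (does (Ever′ uv))
    off (u , v) other = ind-cong (Ever (u , v)) (Ever′ (u , v))
      ([ (λ ever → ever) , (λ (vu , x∈uv , du , dv) → contradiction refl (other vu x∈uv du dv)) ]′ ∘ earlier occ xs u v 1≤k polite)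
      (later occ xs)
    -- The pair that ends is represented with its left place first, so the side on which `z` lies
    -- decides between `(x , z)` and `(z , x)`.
    one-fewer : Adj x z → everCount k occ (x ∷ xs) ≡ 1 + everCount k (x ∷⁺ occ) xs
    one-fewer (inj₁ xz) = fold-change-at +-0-isCommutativeMonoid 1 (cartesianProduct⁺ (allFin⁺ p) (allFin⁺ p))
      (∈-cartesianProduct⁺ (∈-allFin x) (∈-allFin z))
      (trans (ind-yes (Ever (x , z)) (sym xz , here (at-k dx , at-k dz)))
        (cong suc (sym (ind-no (Ever′ (x , z)) λ (_ , any) → proj₁ (never-again (x ∷⁺ occ) xs (x∈x∷⁺ occ x) any) refl))))
      λ uv ≢xz → off uv λ where
        vu (inj₁ refl) _ dv refl → ≢xz (cong (x ,_) (adj-unique occ 1≤k (inj₁ (sym vu)) (inj₁ xz) dv dx dz))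
        vu (inj₂ refl) du _ refl → no-triple occ 1≤k (sym vu) xz du dx dz
    one-fewer (inj₂ zx) = fold-change-at +-0-isCommutativeMonoid 1 (cartesianProduct⁺ (allFin⁺ p) (allFin⁺ p))
      (∈-cartesianProduct⁺ (∈-allFin z) (∈-allFin x))
      (trans (ind-yes (Ever (z , x)) (sym zx , here (at-k dz , at-k dx)))
        (cong suc (sym (ind-no (Ever′ (z , x)) λ (_ , any) → proj₂ (never-again (x ∷⁺ occ) xs (x∈x∷⁺ occ x) any) refl))))
      λ uv ≢zx → off uv λ where
        vu (inj₁ refl) _ dv refl → no-triple occ 1≤k zx (sym vu) dz dx dv
        vu (inj₂ refl) du _ refl → ≢zx (cong (_, x) (adj-unique occ 1≤k (inj₂ (sym vu)) (inj₂ zx) du dx dz))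

-- Left fillings as edge gaps, and the final formula

module Choices (k : ℕ) = Statistic (choices k)
module Pairs (k : ℕ) = Statistic (pairs k)

-- With the first person at the left end, the left edge gap has length 0 and contributes nothing;
-- the right one has length `i`.
b≡outer : (F : ∀ p → LeftFilling p) (i k : ℕ) → b F (suc i) k ≡ Choices.outer k i
b≡outer F i k with proj₁ (F (suc i)) | proj₂ (F (suc i))
... | x ∷ xs | polites , x≡0 = trans (choices≡B k (x ∷ []) xs (remaining-first x) polites)
  (trans (Choices.total-single k x) (cong (λ n → Choices.outer k n + Choices.outer k (i ∸ n)) x≡0))

-- Matches the convention that `d` vanishes at distance 1: there `⌊ g /2⌋` is 0, and `middlePaired`
-- is false.
pairs-1-inner : ∀ f g → Pairs.innerWithin 1 f g ≡ 0
pairs-1-inner zero    zero    = refl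
pairs-1-inner (suc f) zero    = refl
pairs-1-inner zero    (suc g) = refl
pairs-1-inner (suc f) (suc g) = cong₂ _+_ middle (cong₂ _+_ (pairs-1-inner f ⌊ g /2⌋) (pairs-1-inner f ⌈ g /2⌉))
  where
  middle : pairs 1 (suc ⌊ g /2⌋) (middlePaired g) ≡ 0
  middle with ⌊ g /2⌋
  ... | zero  = refl
  ... | suc _ = refl

pairs-outer-suc : ∀ k i → Pairs.outer k (suc i) ≡ Pairs.inner k i
pairs-outer-suc k i = cong (λ t → ind t + Pairs.inner k i) (∧-zeroʳ (does (suc i ≟ k)))

d≡outer : (F : ∀ p → LeftFilling p) (i k : ℕ) → 1 ≤ k → d F (suc i) k ≡ Pairs.outer k i
d≡outer F zero    1 _ = refl
d≡outer F (suc i) 1 _ = sym (trans (pairs-outer-suc 1 i) (pairs-1-inner i i))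
d≡outer F i k@(suc (suc _)) _ with proj₁ (F (suc i)) | proj₂ (F (suc i))
... | x ∷ xs | polites , x≡0 = trans (count (emptyPair? (x ∷ xs) k) neighbours)
  (trans (pairs≡D k (x ∷ []) xs (s≤s (s≤s z≤n)) (remaining-first x) polites)
  (trans (Pairs.total-single k x) (cong (λ n → Pairs.outer k n + Pairs.outer k (i ∸ n)) x≡0)))

a≡sum-orders : ∀ m → a (suc m) ≡ sum (map (λ x → orders (x ∷ [])) (allFin (suc m)))
a≡sum-orders m = trans (count polite? (sequences (suc m) (suc m)))
  (trans (sum-cartesianProductWith _ _∷_ (allFin (suc m)) (sequences (suc m) m))
  (sum-cong (allFin (suc m)) λ x → completions≡orders m (x ∷ []) (remaining-first x)))

-- The edge gaps to the left and right of `x` have lengths `toℕ x` and `m ∸ toℕ x`; a left filling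
-- with one more place has exactly such a gap.
orders-first : (F : ∀ p → LeftFilling p) (m : ℕ) (x : Fin (suc m)) →
  orders (x ∷ []) ≡ product (map (λ j →
    2 ^ (d F (suc (toℕ x)) j + d F (suc m + 1 ∸ suc (toℕ x)) j) * (b F (suc (toℕ x)) j + b F (suc m + 1 ∸ suc (toℕ x)) j) !) (1⋯ m))
orders-first F m x = fold-cong *-1-isCommutativeMonoid (1⋯ m) λ j j∈ → cong₂ (λ s t → 2 ^ s * t !)
  (trans (Pairs.total-single j x) (cong₂ _+_ (sym (d≡outer F (toℕ x) j (positive j∈)))
    (sym (trans (cong (λ i → d F i j) right) (d≡outer F (m ∸ toℕ x) j (positive j∈))))))
  (trans (Choices.total-single j x) (cong₂ _+_ (sym (b≡outer F (toℕ x) j))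
    (sym (trans (cong (λ i → b F i j) right) (b≡outer F (m ∸ toℕ x) j)))))
  where
  positive : ∀ {j} → j ∈ 1⋯ m → 1 ≤ j
  positive j∈ with _ , _ , refl ← ∈-applyUpTo⁻ suc j∈ = s≤s z≤n
  -- The left side is what `n + 1 ∸ i` computes to for `n = suc m` and `i = suc (toℕ x)`; the right
  -- side has the successor form that `b≡outer` and `d≡outer` expect.
  right : m + 1 ∸ toℕ x ≡ suc (m ∸ toℕ x)
  right = trans (cong (_∸ toℕ x) (+-comm m 1)) (+-∸-assoc 1 (≤-pred (toℕ<n x)))

mainTheorem1 : (F : ∀ p → LeftFilling p) (n : ℕ) .{{_ : NonZero n}} →
    a n ≡ sum (map (λ i →
    product (map (λ j →
    2 ^ (d F i j + d F (n + 1 ∸ i) j) * (b F i j + b F (n + 1 ∸ i) j) !)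
    (1⋯ (n ∸ 1))))
    (1⋯ n))
mainTheorem1 F zero    {{n≢0}} = contradiction refl (≢-nonZero⁻¹ 0 {{n≢0}})
mainTheorem1 F (suc m) = trans (a≡sum-orders m) (trans
  (sum-cong (allFin (suc m)) (orders-first F m))
  (sum-1⋯ (λ i → product (map (λ j →
    2 ^ (d F i j + d F (suc m + 1 ∸ i) j) * (b F i j + b F (suc m + 1 ∸ i) j) !) (1⋯ m))) (suc m)))
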